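{- Let $d$ be a power of $2$ and $d'=d+\log_2 d$. For $x\in\{0,1\}^{d'}$ let $\mathsf{val}(x)=\sum_{j=1}^{d'}x_j2^{j-1}$, and write $x\prec y$ if $\mathsf{val}(x)<\mathsf{val}(y)$. For $i\in[d]$ let $C_i=\{x:\mathsf{val}(x_{d'}\cdots x_{d+1})=i-1\}$ (value of the top $\log_2 d$ bits read as a binary number). Sample: $k$ uniformly from $\{1,\dots,\tfrac12\log_2 d\}$; $R\subseteq[d]$ uniformly among sets of size $2^k$; independently for each $i\in[d]$, $r_i$ uniform in $R$; independently for each $b\in[d]$, $\alpha_b$ uniform in $\{\pm1\}$; independently for each $i\in[d]$, $\beta_i$ uniform in $\{\pm1\}$. Let $f(x)=\sum_{b\in[d']\setminus R}x_b3^b+\alpha_{r_i}x_{r_i}3^{r_i}$ and $g(x)=\sum_{b\in[d']\setminus R}x_b3^b+\beta_i x_{r_i}3^{r_i}$, where $i$ is such that $x\in C_i$. For a function $h$ and $x\prec y$ let $\mathsf{sgn}_h(x,y)$ be $1$, $0$, $-1$ according as $h(x)<h(y)$, $h(x)=h(y)$, $h(x)>h(y)$. For a set $Q\subseteq\{0,1\}^{d'}$, let $G^Q_h$ be the signed graph on $Q$ in which each pair $x\prec y$ of $Q$ is joined by an edge labeled $\mathsf{sgn}_h(x,y)$; let $\boldsymbol{G}^Q_Y$ and $\boldsymbol{G}^Q_N$ be the distributions of $G^Q_f$ and $G^Q_g$ respectively. Then there is an absolute constant $C$ such that for all sufficiently small $\delta>0$ and sufficiently large $d$, every $Q$ with $|Q|\le\delta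 d\log d$ satisfies $\|\boldsymbol{G}^Q_Y-\boldsymbol{G}^Q_N\|_{\mathrm{TV}}\le C\delta$.
   Context: $\|\cdot\|_{\mathrm{TV}}$ denotes total variation distance between distributions. -}

module Defs where

open import Data.Bool using (Bool; true; false; if_then_else_)
open import Data.Nat as ℕ using (ℕ; zero; suc; _^_; _<ᵇ_)
open import Data.Nat.Properties using (*-comm)
open import Data.Integer as ℤ using (ℤ; +_; -[1+_])
open import Data.Rational as ℚ using (ℚ; ½; 0ℚ)
open import Data.Fin as Fin using (Fin; toℕ; _↑ˡ_; _↑ʳ_; combine; cast)
open import Data.Vec as Vec using (Vec; lookup)
open import Data.Vec.Properties as VecP using ()
open import Data.List as List using (List; []; _∷_; map; concatMap; _++_; foldr; allFin; upTo; deduplicate; length)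
open import Data.List.Properties as ListP using ()
open import Data.Product using (_×_; _,_; proj₁; proj₂)
open import Data.Vec.Functional as VF using ()
open import Relation.Nullary using (Dec; yes; no)
open import Relation.Binary.PropositionalEquality using (_≡_)
open import Relation.Binary using (DecidableEquality)

dim : ℕ → ℕ
dim m = 2 ^ m

dim' : ℕ → ℕ
dim' m = 2 ^ m ℕ.+ m

-- Points of {0,1}^{d'}; coordinate j (1-based) is stored at Fin index j-1.
Point : ℕ → Set
Point m = Vec Bool (dim' m)

bit : Bool → ℕ
bit true  = 1
bit false = 0

val : ∀ {n} → Vec Bool n → ℕ
val Vec.[] = 0
val (b Vec.∷ xs) = bit b ℕ.+ 2 ℕ.* val xs

_≺_ : ∀ {n} → Vec Bool n → Vec Bool n → Set
x ≺ y = val x ℕ.< val y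

-- binary number b₀ + 2 b₁ + … as an element of Fin (2 ^ m)
bitsToFin : (m : ℕ) → (Fin m → Bool) → Fin (2 ^ m)
bitsToFin zero    b = Fin.zero
bitsToFin (suc m) b =
  cast (*-comm (2 ^ m) 2)
       (combine (bitsToFin m (λ j → b (Fin.suc j)))
                (if b Fin.zero then Fin.suc Fin.zero else Fin.zero))

-- Cell index i-1 ∈ Fin d of x: value of the top m bits x_{d'} … x_{d+1}
-- (x_{d+1} least significant).  C_i = { x : cell x = i-1 }.
cell : ∀ m → Point m → Fin (dim m)
cell m x = bitsToFin m (λ j → lookup x (dim m ↑ʳ j))

low : ∀ m → Fin (dim m) → Fin (dim' m)
low m c = c ↑ˡ m

sumℤ : List ℤ → ℤ
sumℤ = foldr ℤ._+_ (+ 0)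

sumℚ : List ℚ → ℚ
sumℚ = foldr ℚ._+_ 0ℚ

anyᵇ : ∀ {A : Set} → (A → Bool) → List A → Bool
anyᵇ p [] = false
anyᵇ p (x ∷ xs) = if p x then true else anyᵇ p xs

_==ᶠ_ : ∀ {n} → Fin n → Fin n → Bool
i ==ᶠ j with i Fin.≟ j
... | yes _ = true
... | no  _ = false

sgnB : Bool → ℤ
sgnB true  = + 1
sgnB false = -[1+ 0 ]

-- The functions f and g.
-- R : the set R ⊆ [d] (as a list of 0-based indices), r : i ↦ r_i ∈ R,
-- s : the sign attached to cell i (α_{r_i} for f, β_i for g).
-- h(x) = Σ_{b ∈ [d'] \ R} x_b 3^b + s_i x_{r_i} 3^{r_i},  i the cell of x.

hFun : ∀ m → List (Fin (dim m)) → (Fin (dim m) → Fin (dim m))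
     → (Fin (dim m) → Bool) → Point m → ℤ
hFun m R r s x =
  sumℤ (map (λ b → if anyᵇ (λ c → low m c ==ᶠ b) R
                     then + 0
                     else + (bit (lookup x b) ℕ.* 3 ^ suc (toℕ b)))
            (allFin (dim' m)))
  ℤ.+ sgnB (s i) ℤ.* + (bit (lookup x (low m (r i))) ℕ.* 3 ^ suc (toℕ (r i)))
  where i = cell m x

fY : ∀ m → List (Fin (dim m)) → (Fin (dim m) → Fin (dim m))
   → (α β : Fin (dim m) → Bool) → Point m → ℤ
fY m R r α β = hFun m R r (λ i → α (r i))

gN : ∀ m → List (Fin (dim m)) → (Fin (dim m) → Fin (dim m))
   → (α β : Fin (dim m) → Bool) → Point m → ℤ
gN m R r α β = hFun m R r β

-- Signed graph G^Q_h: for Q given as a list of distinct points, the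
-- labelled graph is recorded as the list of labels sgn_h(x,y) of all
-- pairs of Q (pairs enumerated by positions in the list, each pair
-- oriented by ≺).  For fixed Q this is a bijective encoding of G^Q_h.

sgnZ : ℤ → ℤ → ℤ
sgnZ a b with a ℤ.<? b | a ℤ.≟ b
... | yes _ | _     = + 1
... | no _  | yes _ = + 0
... | no _  | no _  = -[1+ 0 ]

sgnPair : ∀ {n} → (Vec Bool n → ℤ) → Vec Bool n → Vec Bool n → ℤ
sgnPair h x y = if val x <ᵇ val y then sgnZ (h x) (h y) else sgnZ (h y) (h x)

pairs : ∀ {A : Set} → List A → List (A × A)
pairs [] = []
pairs (x ∷ xs) = map (x ,_) xs ++ pairs xs

graph : ∀ {n} → (Vec Bool n → ℤ) → List (Vec Bool n) → List ℤ
graph h Q = map (λ p → sgnPair h (proj₁ p) (proj₂ p)) (pairs Q)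

Dist : Set → Set
Dist A = List (ℚ × A)

uniform : ∀ {A : Set} → List A → Dist A
uniform [] = []
uniform (x ∷ xs) = map (λ a → (+ 1 ℚ./ suc (length xs)) , a) (x ∷ xs)

_>>=_ : ∀ {A B : Set} → Dist A → (A → Dist B) → Dist B
μ >>= k = concatMap (λ p → map (λ q → (proj₁ p ℚ.* proj₁ q) , proj₂ q) (k (proj₂ p))) μ

return : ∀ {A : Set} → A → Dist A
return a = (ℚ.1ℚ , a) ∷ []

prob : ∀ {A : Set} → DecidableEquality A → Dist A → A → ℚ
prob _≟_ μ a = sumℚ (map (λ p → w p) μ)
  where
  w : _ → ℚ
  w (q , b) with b ≟ a
  ... | yes _ = q
  ... | no  _ = 0ℚ

tv : ∀ {A : Set} → DecidableEquality A → Dist A → Dist A → ℚ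
tv _≟_ μ ν = ½ ℚ.* sumℚ (map (λ o → ℚ.∣ prob _≟_ μ o ℚ.- prob _≟_ ν o ∣)
                              (deduplicate _≟_ (map proj₂ μ ++ map proj₂ ν)))

allFuns : ∀ {A : Set} n → List A → List (Fin n → A)
allFuns zero    xs = (λ ()) ∷ []
allFuns (suc n) xs = concatMap (λ a → map (λ f → a VF.∷ f) (allFuns n xs)) xs

subsetsOfSize : ∀ n → ℕ → List (List (Fin n))
subsetsOfSize zero    zero    = [] ∷ []
subsetsOfSize zero    (suc s) = []
subsetsOfSize (suc n) zero    = [] ∷ []
subsetsOfSize (suc n) (suc s) =
  map (λ S → Fin.zero ∷ map Fin.suc S) (subsetsOfSize n s)
  ++ map (map Fin.suc) (subsetsOfSize n (suc s))

bools : List Bool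
bools = true ∷ false ∷ []

-- k uniform in {1, …, ⌊½ log₂ d⌋} = {1, …, ⌊m/2⌋}
ks : ℕ → List ℕ
ks m = map suc (upTo (m ℕ./ 2))

sampleGraph : ∀ m
  → (List (Fin (dim m)) → (Fin (dim m) → Fin (dim m))
     → (Fin (dim m) → Bool) → (Fin (dim m) → Bool) → Point m → ℤ)
  → List (Point m) → Dist (List ℤ)
sampleGraph m F Q =
  uniform (ks m) >>= λ k →
  uniform (subsetsOfSize (dim m) (2 ^ k)) >>= λ R →
  uniform (allFuns (dim m) R) >>= λ r →
  uniform (allFuns (dim m) bools) >>= λ α →
  uniform (allFuns (dim m) bools) >>= λ β →
  return (graph (F R r α β) Q)

GY GN : ∀ m → List (Point m) → Dist (List ℤ)
GY m Q = sampleGraph m (fY m) Q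
GN m Q = sampleGraph m (gN m) Q

tvGraphs : ∀ m → List (Point m) → ℚ
tvGraphs m Q = tv (ListP.≡-dec ℤ._≟_) (GY m Q) (GN m Q)

toℚ : ℕ → ℚ
toℚ n = + n ℚ./ 1

{-# OPTIONS --safe #-}

-- Write d = 2^m, K = ⌊m/2⌋. Powers of 3 make the label of a pair depend only on the highest coordinate
-- where the values differ. Hence the sign s_i of cell i matters only if r_i is relevant to i: two points
-- of Q in cell i differ at r_i and agree at all higher coordinates outside R. If relevant cells have
-- distinct r_i, then the α_{r_i} and the β_i are both independent uniform signs there, so the total
-- variation distance is at most the probability that two relevant cells collide.
--
-- Let n_c(R) be the number of cells to which c is relevant. Given R with |R| = 2^k, a collision at c ∈ R
-- has probability at most min(1, n_c(R)² / 4^k). As n_c grows with R and ignores whether c ∈ R, R may be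
-- replaced by a set of size 2^K avoiding c, at a cost of 2^k / (d − 2^K). Now only min(4^k, n²) / 2^k
-- depends on k; it sums to at most 4n over k, and Σ_{c ∉ R} n_c(R) ≤ |Q| since each point added to Q
-- creates at most one new pair (c, i) with c ∉ R. So the distance is at most 4 |Q| / (K (d − 2^K)) ≤ 24 δ.
module Submission where

open import Defs
open import Data.Nat using (ℕ; _≤_; _^_; _*_)
open import Data.Rational using (ℚ; 0ℚ) renaming (_<_ to _<ℚ_; _≤_ to _≤ℚ_; _*_ to _*ℚ_)
open import Data.List using (List; length)
open import Data.List.Relation.Unary.Unique.Propositional using (Unique)
open import Data.Product using (Σ; _×_)

open import Data.Bool using (Bool; true; false; if_then_else_)
import Data.Bool.Properties as BoolP
open import Data.Fin as Fin using (Fin; toℕ; punchIn; _↑ʳ_)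
import Data.Fin.Properties as FinP
open import Data.Integer as ℤ using (ℤ; +_; -[1+_]; +<+; +≤+)
import Data.Integer.Properties as ℤP
import Data.Integer.Tactic.RingSolver as ℤSolver
open import Data.List using ([]; _∷_; map; _++_; concatMap; allFin; upTo; deduplicate)
open import Data.List.Membership.DecPropositional using (_∈?_)
open import Data.List.Membership.Propositional using (_∈_; _∉_; find; lose)
open import Data.List.Membership.Propositional.Properties using (∈-map⁻; ∈-map⁺; ∈-++⁻; ∈-allFin)
open import Data.List.Properties as ListP
  using (map-++; map-∘; map-cong; map-cong-local; map-tabulate; length-map; length-++; length-upTo; upTo-∷ʳ)
open import Data.List.Relation.Binary.Subset.Propositional using (_⊆_)
open import Data.List.Relation.Unary.All as All using (All; []; _∷_)
import Data.List.Relation.Unary.All.Properties as AllP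
open import Data.List.Relation.Unary.Any as Any using (Any; here; there)
open import Data.List.Relation.Unary.Unique.DecPropositional.Properties using (deduplicate-!)
open import Data.List.Relation.Unary.Unique.Propositional using ([]; _∷_)
open import Data.List.Relation.Unary.Unique.Propositional.Properties as UniqueP using (allFin⁺)
open import Data.Maybe using (nothing)
open import Data.Nat as ℕ using (zero; suc; _+_; _∸_; _⊓_; _<_; z≤n; s≤s; >-nonZero)
open import Data.Nat.DivMod using (m≡m%n+[m/n]*n; m%n<n; m/n<m; m≥n⇒m/n>0)
open import Data.Nat.ListAction using (sum)
open import Data.Nat.ListAction.Properties using (sum-++)
open import Data.Nat.Properties
open import Data.Nat.Tactic.RingSolver using (solve-∀)
open import Data.Product using (∃; _,_; proj₁; proj₂)
open import Data.Rational as ℚ using (1ℚ; ½; toℚᵘ)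
import Data.Rational.Properties as ℚP
open import Data.Rational.Unnormalised as ℚᵘ using (mkℚᵘ; *≡*; *≤*)
import Data.Rational.Unnormalised.Properties as ℚᵘP
open import Data.Sum using (_⊎_; inj₁; inj₂)
open import Data.Vec using (Vec; lookup)
open import Data.Vec.Functional as VF using (updateAt)
import Data.Vec.Functional.Properties as VFP
open import Function using (_∘_; id; case_of_)
open import Level using (0ℓ)
open import Relation.Binary using (DecidableEquality)
open import Relation.Binary.Definitions using (tri<; tri≈; tri>)
open import Relation.Binary.PropositionalEquality
open import Relation.Nullary using (¬_; Dec; yes; no; contradiction)
open import Relation.Nullary.Decidable using (¬?; _×-dec_; _⊎-dec_; _→-dec_; map′; from-yes)
import Tactic.RingSolver as RingSolver
open import Tactic.RingSolver.Core.AlmostCommutativeRing using (AlmostCommutativeRing; fromCommutativeRing)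

-- Collisions at c ∈ R cannot be bounded by |Q| directly. Coordinates of R are exempt from the
-- agreement above c, so one pair of points of a cell that differ exactly on R makes every c ∈ R
-- relevant to that cell. Only c outside R obey the linear bound, which is why membership of c is
-- exchanged for its absence. All levels are compared with the one size 2^K so that the sum over k
-- can be taken for fixed R and c, where n_c(R) does not depend on k. This sum is the source of the
-- factor log d: a single level can contribute as much as n, since min(4^k, n²) / 2^k ≤ n with
-- equality at n = 2^k, yet all K levels together cost 4n instead of Kn. Counting is done in ℕ with
-- denominators cleared: an average over s-subsets appears as `∑Sub n s φ` set against `choose n s`,
-- and rationals enter only where probabilities are read off.

private variable
  A B : Set
  P P′ : Set
  n : ℕ

-- Indicators and finite sums of natural numbers.

ind : Dec P → ℕ
ind (yes _) = 1
ind (no _)  = 0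

ind-true : (d : Dec P) → P → ind d ≡ 1
ind-true (yes _) p = refl
ind-true (no ¬p) p = contradiction p ¬p

ind-false : (d : Dec P) → ¬ P → ind d ≡ 0
ind-false (yes p) ¬p = contradiction p ¬p
ind-false (no _)  _  = refl

ind-mono : (d : Dec P) (d′ : Dec P′) → (P → P′) → ind d ≤ ind d′
ind-mono (yes p) d′ f = ≤-reflexive (sym (ind-true d′ (f p)))
ind-mono (no _)  d′ f = z≤n

ind≤1 : (d : Dec P) → ind d ≤ 1
ind≤1 (yes _) = ≤-refl
ind≤1 (no _)  = z≤n

ind-pos : (d : Dec P) → 0 < ind d → P
ind-pos (yes p) _ = p

∑ : List A → (A → ℕ) → ℕ
∑ xs f = sum (map f xs)

∑-mono-∈ : (xs : List A) {f g : A → ℕ} → (∀ x → x ∈ xs → f x ≤ g x) → ∑ xs f ≤ ∑ xs g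
∑-mono-∈ []       h = z≤n
∑-mono-∈ (x ∷ xs) h = +-mono-≤ (h x (here refl)) (∑-mono-∈ xs (λ y y∈ → h y (there y∈)))

∑-mono : (xs : List A) {f g : A → ℕ} → (∀ x → f x ≤ g x) → ∑ xs f ≤ ∑ xs g
∑-mono xs h = ∑-mono-∈ xs (λ x _ → h x)

∑-cong : (xs : List A) {f g : A → ℕ} → (∀ x → f x ≡ g x) → ∑ xs f ≡ ∑ xs g
∑-cong xs h = cong sum (map-cong h xs)

∑-++ : (xs ys : List A) (f : A → ℕ) → ∑ (xs ++ ys) f ≡ ∑ xs f + ∑ ys f
∑-++ xs ys f = trans (cong sum (map-++ f xs ys)) (sum-++ (map f xs) (map f ys))

∑-map : (g : A → B) (xs : List A) (f : B → ℕ) → ∑ (map g xs) f ≡ ∑ xs (f ∘ g)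
∑-map g xs f = cong sum (sym (map-∘ xs))

∑-concatMap : (g : A → List B) (xs : List A) (f : B → ℕ) →
              ∑ (concatMap g xs) f ≡ ∑ xs (λ x → ∑ (g x) f)
∑-concatMap g []       f = refl
∑-concatMap g (x ∷ xs) f =
  trans (∑-++ (g x) (concatMap g xs) f) (cong (_+_ (∑ (g x) f)) (∑-concatMap g xs f))

∑-+ : (xs : List A) (f g : A → ℕ) → ∑ xs (λ x → f x + g x) ≡ ∑ xs f + ∑ xs g
∑-+ []       f g = refl
∑-+ (x ∷ xs) f g rewrite ∑-+ xs f g = shuffle (f x) (g x) (∑ xs f) (∑ xs g)
  where
  shuffle : ∀ a b c d → a + b + (c + d) ≡ a + c + (b + d)
  shuffle = solve-∀

∑-*ˡ : (xs : List A) (c : ℕ) (f : A → ℕ) → ∑ xs (λ x → c * f x) ≡ c * ∑ xs f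
∑-*ˡ []       c f = sym (*-zeroʳ c)
∑-*ˡ (x ∷ xs) c f rewrite ∑-*ˡ xs c f = sym (*-distribˡ-+ c (f x) (∑ xs f))

∑-const : (xs : List A) (c : ℕ) → ∑ xs (λ _ → c) ≡ length xs * c
∑-const []       c = refl
∑-const (x ∷ xs) c = cong (_+_ c) (∑-const xs c)

∑-swap : (xs : List A) (ys : List B) (f : A → B → ℕ) →
         ∑ xs (λ x → ∑ ys (f x)) ≡ ∑ ys (λ y → ∑ xs (λ x → f x y))
∑-swap []       ys f = trans (sym (*-zeroʳ (length ys))) (sym (∑-const ys 0))
∑-swap (x ∷ xs) ys f =
  trans (cong (_+_ (∑ ys (f x))) (∑-swap xs ys f)) (sym (∑-+ ys (f x) _))

∑-pos : (xs : List A) (f : A → ℕ) → 0 < ∑ xs f → ∃ λ x → x ∈ xs × 0 < f x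
∑-pos (x ∷ xs) f pos with f x in eq
... | suc _ = x , here refl , subst (0 <_) (sym eq) (s≤s z≤n)
... | zero  = let y , y∈ , p = ∑-pos xs f pos in y , there y∈ , p

∑-∈ : {xs : List A} {x : A} (f : A → ℕ) → x ∈ xs → f x ≤ ∑ xs f
∑-∈ f (here refl) = m≤m+n _ _
∑-∈ f (there x∈)  = ≤-trans (∑-∈ f x∈) (m≤n+m _ _)

∑-zero : (xs : List A) (f : A → ℕ) → (∀ x → x ∈ xs → f x ≡ 0) → ∑ xs f ≡ 0
∑-zero []       f h = refl
∑-zero (x ∷ xs) f h = cong₂ _+_ (h x (here refl)) (∑-zero xs f (λ y y∈ → h y (there y∈)))

-- The form in which uniqueness statements enter sums: the uniqueness of a new relevant pair, and
-- the disjointness of the events that fix an outcome.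
∑-≤1 : {xs : List A} → Unique xs → (f : A → ℕ) → (∀ x → f x ≤ 1) →
       (∀ x y → 0 < f x → 0 < f y → x ≡ y) → ∑ xs f ≤ 1
∑-≤1 [] f _ _ = z≤n
∑-≤1 {xs = x ∷ xs} (x∉ ∷ u) f f≤1 same with f x in eq
... | zero  = ∑-≤1 u f f≤1 same
... | suc n = begin
  suc n + ∑ xs f ≡⟨ cong (_+_ (suc n)) (∑-zero xs f others) ⟩
  suc n + 0      ≡⟨ +-identityʳ (suc n) ⟩
  suc n          ≡⟨ sym eq ⟩
  f x            ≤⟨ f≤1 x ⟩
  1              ∎
  where
  open ≤-Reasoning
  fx>0 : 0 < f x
  fx>0 = subst (0 <_) (sym eq) (s≤s z≤n)
  distinct : ∀ {zs y} → All (x ≢_) zs → y ∈ zs → x ≢ y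
  distinct (px ∷ _)  (here refl) = px
  distinct (_ ∷ pxs) (there y∈)  = distinct pxs y∈
  others : ∀ y → y ∈ xs → f y ≡ 0
  others y y∈ with f y in eqy
  ... | zero  = refl
  ... | suc _ = contradiction (same x y fx>0 (subst (0 <_) (sym eqy) (s≤s z≤n)))
                              (distinct x∉ y∈)

∑-ind-≡ : {xs : List A} (_≟_ : ∀ (x y : A) → Dec (x ≡ y)) → Unique xs → ∀ c → ∑ xs (λ a → ind (a ≟ c)) ≤ 1
∑-ind-≡ _≟_ u c = ∑-≤1 u _ (λ a → ind≤1 (a ≟ c))
  (λ x y p q → trans (ind-pos (x ≟ c) p) (sym (ind-pos (y ≟ c) q)))

-- Averages over subsets of fixed size

∑Sub : ∀ n → ℕ → (List (Fin n) → ℕ) → ℕ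
∑Sub n s = ∑ (subsetsOfSize n s)

_∋?_ : (R : List (Fin n)) (c : Fin n) → Dec (c ∈ R)
R ∋? c = _∈?_ FinP._≟_ c R

choose : ℕ → ℕ → ℕ
choose n s = length (subsetsOfSize n s)

prepend lift : (List (Fin (suc n)) → ℕ) → List (Fin n) → ℕ
prepend φ R = φ (Fin.zero ∷ map Fin.suc R)
lift    φ R = φ (map Fin.suc R)

∑Sub-suc : ∀ n s (φ : List (Fin (suc n)) → ℕ) →
           ∑Sub (suc n) (suc s) φ ≡ ∑Sub n s (prepend φ) + ∑Sub n (suc s) (lift φ)
∑Sub-suc n s φ = trans (∑-++ (map _ (subsetsOfSize n s)) (map _ (subsetsOfSize n (suc s))) φ)
  (cong₂ _+_ (∑-map _ (subsetsOfSize n s) φ) (∑-map _ (subsetsOfSize n (suc s)) φ))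

∑Sub-0 : ∀ n (φ : List (Fin n) → ℕ) → ∑Sub n 0 φ ≡ φ []
∑Sub-0 zero    φ = +-identityʳ (φ [])
∑Sub-0 (suc n) φ = +-identityʳ (φ [])

choose-0 : ∀ n → choose n 0 ≡ 1
choose-0 zero    = refl
choose-0 (suc n) = refl

choose-suc : ∀ n s → choose (suc n) (suc s) ≡ choose n s + choose n (suc s)
choose-suc n s = trans (length-++ (map _ (subsetsOfSize n s)))
  (cong₂ _+_ (length-map _ (subsetsOfSize n s)) (length-map _ (subsetsOfSize n (suc s))))

-- Both sides count the (s+1)-subsets of an (n+1)-set with one marked element, which may be chosen
-- last or first.
absorption : ∀ n s → suc s * choose (suc n) (suc s) ≡ suc n * choose n s
absorption zero    zero    = refl
absorption zero    (suc s) = *-zeroʳ (suc s)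
absorption (suc n) zero    = begin
  1 * choose (suc (suc n)) 1  ≡⟨ *-identityˡ _ ⟩
  choose (suc (suc n)) 1      ≡⟨ choose-suc (suc n) 0 ⟩
  1 + choose (suc n) 1        ≡⟨ cong suc (sym (*-identityˡ _)) ⟩
  1 + 1 * choose (suc n) 1    ≡⟨ cong suc (absorption n zero) ⟩
  1 + suc n * choose n 0      ≡⟨ cong (λ z → 1 + suc n * z) (choose-0 n) ⟩
  1 + suc n * 1               ∎
  where open ≡-Reasoning
absorption (suc n) (suc s) = begin
  suc (suc s) * choose (suc (suc n)) (suc (suc s))  ≡⟨ cong (suc (suc s) *_) (choose-suc (suc n) (suc s)) ⟩
  suc (suc s) * (a + b)                             ≡⟨ split s a b ⟩
  a + (suc s * a + suc (suc s) * b)                 ≡⟨ cong (_+_ a) (cong₂ _+_ (absorption n s) (absorption n (suc s))) ⟩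
  a + (suc n * choose n s + suc n * choose n (suc s)) ≡⟨ cong (_+_ a) (sym (*-distribˡ-+ (suc n) (choose n s) (choose n (suc s)))) ⟩
  a + suc n * (choose n s + choose n (suc s))       ≡⟨ cong (λ z → a + suc n * z) (sym (choose-suc n s)) ⟩
  suc (suc n) * a                                   ∎
  where
  open ≡-Reasoning
  a = choose (suc n) (suc s)
  b = choose (suc n) (suc (suc s))
  split : ∀ s a b → suc (suc s) * (a + b) ≡ a + (suc s * a + suc (suc s) * b)
  split = solve-∀

-- Counts pairs of an s-subset and an element of the (n+1)-set, according to whether the element
-- lies outside or inside the subset. It is (n+1-s) · C(n+1, s) = (n+1) · C(n, s) without
-- subtraction.
absorption′ : ∀ n s → suc n * choose (suc n) s ≡ suc n * choose n s + s * choose (suc n) s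
absorption′ n zero    rewrite choose-0 n = sym (+-identityʳ _)
absorption′ n (suc s) = begin
  suc n * choose (suc n) (suc s)                    ≡⟨ cong (suc n *_) (choose-suc n s) ⟩
  suc n * (choose n s + choose n (suc s))           ≡⟨ *-distribˡ-+ (suc n) (choose n s) _ ⟩
  suc n * choose n s + suc n * choose n (suc s)     ≡⟨ +-comm (suc n * choose n s) _ ⟩
  suc n * choose n (suc s) + suc n * choose n s     ≡⟨ cong (_+_ (suc n * choose n (suc s))) (sym (absorption n s)) ⟩
  suc n * choose n (suc s) + suc s * choose (suc n) (suc s) ∎
  where open ≡-Reasoning

-- The case φ = 1 of `∑Sub-step`, where equality holds; it serves to normalise that lemma.
choose-step : ∀ n s → n * choose n s ≡ s * choose n s + suc s * choose n (suc s)
choose-step zero    zero    = refl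
choose-step zero    (suc s) = sym (cong₂ _+_ (*-zeroʳ s) (*-zeroʳ s))
choose-step (suc n) s       = begin
  suc n * choose (suc n) s                              ≡⟨ absorption′ n s ⟩
  suc n * choose n s + s * choose (suc n) s             ≡⟨ +-comm (suc n * choose n s) _ ⟩
  s * choose (suc n) s + suc n * choose n s             ≡⟨ cong (_+_ (s * choose (suc n) s)) (sym (absorption n s)) ⟩
  s * choose (suc n) s + suc s * choose (suc n) (suc s) ∎
  where open ≡-Reasoning

choose-pos : ∀ n s → s ≤ n → 0 < choose n s
choose-pos n       zero    _         = subst (0 <_) (sym (choose-0 n)) (s≤s z≤n)
choose-pos (suc n) (suc s) (s≤s s≤n) =
  subst (0 <_) (sym (choose-suc n s)) (≤-trans (choose-pos n s s≤n) (m≤m+n _ _))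

Monotone : (List (Fin n) → ℕ) → Set
Monotone φ = ∀ {R R′} → R ⊆ R′ → φ R ≤ φ R′

map-⊆ : ∀ {A B : Set} (f : A → B) {R R′ : List A} → R ⊆ R′ → map f R ⊆ map f R′
map-⊆ f R⊆R′ x∈ with ∈-map⁻ f x∈
... | y , y∈ , refl = ∈-map⁺ f (R⊆R′ y∈)

prepend-mono : {φ : List (Fin (suc n)) → ℕ} → Monotone φ → Monotone (prepend φ)
prepend-mono mono R⊆R′ = mono λ where
  (here p)  → here p
  (there p) → there (map-⊆ Fin.suc R⊆R′ p)

-- Double counting of the pairs R ⊂ R ∪ {x}; the subtraction in (n − s) · ∑Sub n s φ is moved to the right.
∑Sub-step : ∀ n s {φ : List (Fin n) → ℕ} → Monotone φ →
            n * ∑Sub n s φ ≤ s * ∑Sub n s φ + suc s * ∑Sub n (suc s) φ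
∑Sub-step zero s mono = z≤n
∑Sub-step (suc n) zero {φ} mono = begin
  suc n * ∑Sub (suc n) 0 φ                      ≡⟨ cong (suc n *_) (∑Sub-0 (suc n) φ) ⟩
  φ [] + n * φ []                               ≤⟨ +-mono-≤ (mono (λ ())) ih ⟩
  prepend φ [] + 1 * ∑Sub n 1 (lift φ)          ≡⟨ cong₂ _+_ (sym (∑Sub-0 n (prepend φ))) (*-identityˡ _) ⟩
  ∑Sub n 0 (prepend φ) + ∑Sub n 1 (lift φ)      ≡⟨ sym (∑Sub-suc n 0 φ) ⟩
  ∑Sub (suc n) 1 φ                              ≡⟨ sym (*-identityˡ _) ⟩
  1 * ∑Sub (suc n) 1 φ                          ∎
  where
  open ≤-Reasoning
  ih : n * φ [] ≤ 1 * ∑Sub n 1 (lift φ)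
  ih = subst (λ z → n * z ≤ 1 * ∑Sub n 1 (lift φ)) (∑Sub-0 n (lift φ))
             (∑Sub-step n zero {lift φ} (mono ∘ map-⊆ Fin.suc))
∑Sub-step (suc n) (suc s) {φ} mono
  rewrite ∑Sub-suc n s φ | ∑Sub-suc n (suc s) φ = begin
  suc n * (a + b)                                                     ≡⟨ expand n a b ⟩
  (n * a + n * b) + (a + b)                                           ≤⟨ +-monoˡ-≤ (a + b) (+-mono-≤
     (∑Sub-step n s {prepend φ} (prepend-mono mono))
     (∑Sub-step n (suc s) {lift φ} (mono ∘ map-⊆ Fin.suc))) ⟩
  ((s * a + suc s * b₁) + (suc s * b + suc (suc s) * c)) + (a + b)    ≡⟨ regroup s a b b₁ c ⟩
  -- The spare `b` stands for the pairs in which the added element is zero, the only pairs that the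
  -- two recursive calls do not see; monotonicity is applied to them directly.
  b + (suc s * (a + b) + (suc s * b₁ + suc (suc s) * c))              ≤⟨ +-monoˡ-≤ _ b≤b₁ ⟩
  b₁ + (suc s * (a + b) + (suc s * b₁ + suc (suc s) * c))             ≡⟨ collect s a b b₁ c ⟩
  suc s * (a + b) + suc (suc s) * (b₁ + c)                            ∎
  where
  open ≤-Reasoning
  a = ∑Sub n s (prepend φ)
  b = ∑Sub n (suc s) (lift φ)
  b₁ = ∑Sub n (suc s) (prepend φ)
  c = ∑Sub n (suc (suc s)) (lift φ)
  b≤b₁ : b ≤ b₁
  b≤b₁ = ∑-mono (subsetsOfSize n (suc s)) (λ R → mono there)
  expand : ∀ n a b → suc n * (a + b) ≡ (n * a + n * b) + (a + b)
  expand = solve-∀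
  regroup : ∀ s a b b₁ c → ((s * a + suc s * b₁) + (suc s * b + suc (suc s) * c)) + (a + b)
            ≡ b + (suc s * (a + b) + (suc s * b₁ + suc (suc s) * c))
  regroup = solve-∀
  collect : ∀ s a b b₁ c → b₁ + (suc s * (a + b) + (suc s * b₁ + suc (suc s) * c))
            ≡ suc s * (a + b) + suc (suc s) * (b₁ + c)
  collect = solve-∀

-- Substituting `choose-step` into `∑Sub-step` and cancelling the common term s · (c · e) turns the
-- double count into a comparison of averages, from size s to size s + 1.
∑Sub-step′ : ∀ n s {φ : List (Fin n) → ℕ} → Monotone φ →
             choose n (suc s) * ∑Sub n s φ ≤ choose n s * ∑Sub n (suc s) φ
∑Sub-step′ n s {φ} mono = *-cancelˡ-≤ (suc s) (+-cancelˡ-≤ (s * (c * e)) _ _ (begin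
  s * (c * e) + suc s * (c′ * e)   ≡⟨ l s c e c′ ⟩
  (s * c + suc s * c′) * e         ≡⟨ cong (_* e) (sym (choose-step n s)) ⟩
  (n * c) * e                      ≡⟨ m n c e ⟩
  c * (n * e)                      ≤⟨ *-monoʳ-≤ c (∑Sub-step n s mono) ⟩
  c * (s * e + suc s * e′)         ≡⟨ r s c e e′ ⟩
  s * (c * e) + suc s * (c * e′)   ∎))
  where
  open ≤-Reasoning
  c = choose n s
  c′ = choose n (suc s)
  e = ∑Sub n s φ
  e′ = ∑Sub n (suc s) φ
  l : ∀ s c e c′ → s * (c * e) + suc s * (c′ * e) ≡ (s * c + suc s * c′) * e
  l = solve-∀
  m : ∀ n c e → (n * c) * e ≡ c * (n * e)
  m = solve-∀
  r : ∀ s c e e′ → c * (s * e + suc s * e′) ≡ s * (c * e) + suc s * (c * e′)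
  r = solve-∀

∑Sub-avg-mono : ∀ n s t {φ : List (Fin n) → ℕ} → Monotone φ → t + s ≤ n →
                choose n (t + s) * ∑Sub n s φ ≤ choose n s * ∑Sub n (t + s) φ
∑Sub-avg-mono n s zero    mono _  = ≤-refl
-- Chaining two cross-multiplied comparisons requires cancelling the middle count, which is positive
-- because t + s does not exceed n.
∑Sub-avg-mono n s (suc t) {φ} mono le = *-cancelˡ-≤ x {{>-nonZero (choose-pos n (t + s) (<⇒≤ le))}} (begin
  x * (x′ * e)    ≡⟨ p x x′ e ⟩
  x′ * (x * e)    ≤⟨ *-monoʳ-≤ x′ (∑Sub-avg-mono n s t mono (<⇒≤ le)) ⟩
  x′ * (y * f)    ≡⟨ p x′ y f ⟩
  y * (x′ * f)    ≤⟨ *-monoʳ-≤ y (∑Sub-step′ n (t + s) mono) ⟩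
  y * (x * f′)    ≡⟨ p y x f′ ⟩
  x * (y * f′)    ∎)
  where
  open ≤-Reasoning
  x = choose n (t + s)
  x′ = choose n (suc t + s)
  y = choose n s
  e = ∑Sub n s φ
  f = ∑Sub n (t + s) φ
  f′ = ∑Sub n (suc t + s) φ
  p : ∀ a b c → a * (b * c) ≡ b * (a * c)
  p = solve-∀

-- Two properties in one: φ is monotone, and adding or removing c does not change it, since the
-- condition then holds in both directions.
MonotoneAwayFrom : Fin n → (List (Fin n) → ℕ) → Set
MonotoneAwayFrom c φ = ∀ {R R′} → (∀ b → b ≢ c → b ∈ R → b ∈ R′) → φ R ≤ φ R′

suc∈map⁻ : {c : Fin n} {R : List (Fin n)} → Fin.suc c ∈ map Fin.suc R → c ∈ R
suc∈map⁻ p with ∈-map⁻ Fin.suc p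
... | y , y∈ , refl = y∈

zero∉map : {R : List (Fin n)} → Fin.zero ∉ map Fin.suc R
zero∉map p with ∈-map⁻ Fin.suc p
... | y , y∈ , ()

has misses : Fin n → List (Fin n) → ℕ
has    c R = ind (R ∋? c)
misses c R = ind (¬? (R ∋? c))

has-mono : ∀ {n′} {c : Fin n} {c′ : Fin n′} {R R′} → (c ∈ R → c′ ∈ R′) → has c R ≤ has c′ R′
has-mono {c = c} {c′} {R} {R′} = ind-mono (R ∋? c) (R′ ∋? c′)

misses-anti : ∀ {n′} {c : Fin n} {c′ : Fin n′} {R R′} → (c′ ∈ R′ → c ∈ R) → misses c R ≤ misses c′ R′
misses-anti {c = c} {c′} {R} {R′} h = ind-mono (¬? (R ∋? c)) (¬? (R′ ∋? c′)) (_∘ h)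

has-∉ : {c : Fin n} {R : List (Fin n)} → c ∉ R → has c R ≡ 0
has-∉ {c = c} {R} = ind-false (R ∋? c)

misses-∉ : {c : Fin n} {R : List (Fin n)} → c ∉ R → misses c R ≡ 1
misses-∉ {c = c} {R} = ind-true (¬? (R ∋? c))

misses-∈ : {c : Fin n} {R : List (Fin n)} → c ∈ R → misses c R ≡ 0
misses-∈ {c = c} {R} c∈ = ind-false (¬? (R ∋? c)) (λ c∉ → c∉ c∈)

punchIn-lift : (c : Fin (suc n)) (R : List (Fin n)) →
               map (punchIn (Fin.suc c)) (map Fin.suc R) ≡ map Fin.suc (map (punchIn c) R)
punchIn-lift c R = trans (sym (map-∘ R)) (map-∘ R)

∑Sub-punchIn-suc : ∀ n s (c : Fin (suc n)) (φ : List (Fin (suc (suc n))) → ℕ) →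
  ∑Sub (suc n) (suc s) (φ ∘ map (punchIn (Fin.suc c)))
  ≡ ∑Sub n s (prepend φ ∘ map (punchIn c)) + ∑Sub n (suc s) (lift φ ∘ map (punchIn c))
∑Sub-punchIn-suc n s c φ = trans (∑Sub-suc n s (φ ∘ map (punchIn (Fin.suc c)))) (cong₂ _+_
  (∑-cong (subsetsOfSize n s) (λ R → cong (λ z → φ (Fin.zero ∷ z)) (punchIn-lift c R)))
  (∑-cong (subsetsOfSize n (suc s)) (λ R → cong φ (punchIn-lift c R))))

-- `punchIn c` enumerates all indices except c in increasing order, so the subsets that avoid c are
-- exactly the images of the subsets of a set with one element less.
∑Sub-∌ : ∀ n s (c : Fin (suc n)) (φ : List (Fin (suc n)) → ℕ) →
         ∑Sub (suc n) s (λ R → misses c R * φ R) ≡ ∑Sub n s (φ ∘ map (punchIn c))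
∑Sub-∌ n zero c φ = begin
  ∑Sub (suc n) 0 (λ R → misses c R * φ R)  ≡⟨ ∑Sub-0 (suc n) (λ R → misses c R * φ R) ⟩
  misses c [] * φ []                       ≡⟨ cong (_* φ []) (misses-∉ {c = c} {[]} (λ ())) ⟩
  1 * φ []                                 ≡⟨ *-identityˡ (φ []) ⟩
  φ []                                     ≡⟨ sym (∑Sub-0 n (φ ∘ map (punchIn c))) ⟩
  ∑Sub n 0 (φ ∘ map (punchIn c))           ∎
  where open ≡-Reasoning
∑Sub-∌ n (suc s) Fin.zero φ = begin
  ∑Sub (suc n) (suc s) (λ R → misses Fin.zero R * φ R)
    ≡⟨ ∑Sub-suc n s (λ R → misses Fin.zero R * φ R) ⟩
  ∑Sub n s (λ R → misses Fin.zero (Fin.zero ∷ map Fin.suc R) * prepend φ R)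
    + ∑Sub n (suc s) (λ R → misses Fin.zero (map Fin.suc R) * lift φ R)
    ≡⟨ cong₂ _+_
         (∑-zero (subsetsOfSize n s) _ (λ R _ → cong (_* prepend φ R)
            (misses-∈ {c = Fin.zero} {Fin.zero ∷ map Fin.suc R} (here refl))))
         (∑-cong (subsetsOfSize n (suc s)) (λ R →
            trans (cong (_* lift φ R) (misses-∉ {R = map Fin.suc R} zero∉map)) (*-identityˡ (lift φ R)))) ⟩
  ∑Sub n (suc s) (φ ∘ map Fin.suc) ∎
  where open ≡-Reasoning
∑Sub-∌ (suc n) (suc s) (Fin.suc c) φ = begin
  ∑Sub (suc (suc n)) (suc s) (λ R → misses (Fin.suc c) R * φ R)
    ≡⟨ ∑Sub-suc (suc n) s (λ R → misses (Fin.suc c) R * φ R) ⟩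
  ∑Sub (suc n) s (λ R → misses (Fin.suc c) (Fin.zero ∷ map Fin.suc R) * prepend φ R)
    + ∑Sub (suc n) (suc s) (λ R → misses (Fin.suc c) (map Fin.suc R) * lift φ R)
    ≡⟨ cong₂ _+_ (∑-cong (subsetsOfSize (suc n) s) (λ R → cong (_* prepend φ R) (same₁ R)))
                 (∑-cong (subsetsOfSize (suc n) (suc s)) (λ R → cong (_* lift φ R) (same₀ R))) ⟩
  ∑Sub (suc n) s (λ R → misses c R * prepend φ R) + ∑Sub (suc n) (suc s) (λ R → misses c R * lift φ R)
    ≡⟨ cong₂ _+_ (∑Sub-∌ n s c (prepend φ)) (∑Sub-∌ n (suc s) c (lift φ)) ⟩
  ∑Sub n s (prepend φ ∘ map (punchIn c)) + ∑Sub n (suc s) (lift φ ∘ map (punchIn c))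
    ≡⟨ sym (∑Sub-punchIn-suc n s c φ) ⟩
  ∑Sub (suc n) (suc s) (φ ∘ map (punchIn (Fin.suc c))) ∎
  where
  open ≡-Reasoning
  same₁ : ∀ R → misses (Fin.suc c) (Fin.zero ∷ map Fin.suc R) ≡ misses c R
  same₁ R = ≤-antisym
    (misses-anti {c = Fin.suc c} {c} {Fin.zero ∷ map Fin.suc R} {R} (λ p → there (∈-map⁺ Fin.suc p)))
    (misses-anti {c = c} {Fin.suc c} {R} {Fin.zero ∷ map Fin.suc R} (λ { (there p) → suc∈map⁻ p }))
  same₀ : ∀ R → misses (Fin.suc c) (map Fin.suc R) ≡ misses c R
  same₀ R = ≤-antisym
    (misses-anti {c = Fin.suc c} {c} {map Fin.suc R} {R} (∈-map⁺ Fin.suc))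
    (misses-anti {c = c} {Fin.suc c} {R} {map Fin.suc R} suc∈map⁻)

-- Deleting c from a set of size s + 1 that contains it leaves an s-subset of the other indices, and
-- φ does not notice the deletion. The recursion follows whether zero belongs to the set.
∑Sub-∋ : ∀ n s (c : Fin (suc n)) {φ : List (Fin (suc n)) → ℕ} → MonotoneAwayFrom c φ →
         ∑Sub (suc n) (suc s) (λ R → has c R * φ R) ≤ ∑Sub n s (φ ∘ map (punchIn c))
∑Sub-∋ n s Fin.zero {φ} mono = begin
  ∑Sub (suc n) (suc s) (λ R → has Fin.zero R * φ R)
    ≡⟨ ∑Sub-suc n s (λ R → has Fin.zero R * φ R) ⟩
  ∑Sub n s (λ R → has Fin.zero (Fin.zero ∷ map Fin.suc R) * prepend φ R)
    + ∑Sub n (suc s) (λ R → has Fin.zero (map Fin.suc R) * lift φ R)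
    ≤⟨ +-mono-≤
         (∑-mono (subsetsOfSize n s) (λ R → ≤-trans
            (*-monoˡ-≤ (prepend φ R) (ind≤1 ((Fin.zero ∷ map Fin.suc R) ∋? Fin.zero)))
            (≤-trans (≤-reflexive (*-identityˡ (prepend φ R))) (mono drop-zero))))
         (≤-reflexive (∑-zero (subsetsOfSize n (suc s)) _ (λ R _ →
            cong (_* lift φ R) (has-∉ {R = map Fin.suc R} zero∉map)))) ⟩
  ∑Sub n s (lift φ) + 0   ≡⟨ +-identityʳ _ ⟩
  ∑Sub n s (φ ∘ map Fin.suc) ∎
  where
  open ≤-Reasoning
  drop-zero : ∀ {R : List (Fin n)} b → b ≢ Fin.zero → b ∈ (Fin.zero ∷ map Fin.suc R) → b ∈ map Fin.suc R
  drop-zero b b≢ (here refl) = contradiction refl b≢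
  drop-zero b b≢ (there p)   = p
∑Sub-∋ (suc n) s (Fin.suc c) {φ} mono =
  ≤-trans (≤-reflexive (∑Sub-suc (suc n) s (λ R → has (Fin.suc c) R * φ R))) (go s)
  where
  open ≤-Reasoning
  shift : ∀ {R R′} → (∀ b → b ≢ c → b ∈ R → b ∈ R′) →
          ∀ b → b ≢ Fin.suc c → b ∈ map Fin.suc R → b ∈ map Fin.suc R′
  shift h b b≢ p with ∈-map⁻ Fin.suc p
  ... | y , y∈ , refl = ∈-map⁺ Fin.suc (h y (λ e → b≢ (cong Fin.suc e)) y∈)
  mono₁ : MonotoneAwayFrom c (prepend φ)
  mono₁ h = mono λ where
    b b≢ (here p)  → here p
    b b≢ (there p) → there (shift h b b≢ p)
  mono₀ : MonotoneAwayFrom c (lift φ)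
  mono₀ h = mono (shift h)
  with-zero without-zero : List (Fin (suc n)) → ℕ
  with-zero    R = has (Fin.suc c) (Fin.zero ∷ map Fin.suc R) * prepend φ R
  without-zero R = has (Fin.suc c) (map Fin.suc R) * lift φ R
  part₁ : ∀ R → with-zero R ≤ has c R * prepend φ R
  part₁ R = *-monoˡ-≤ (prepend φ R)
    (has-mono {c = Fin.suc c} {c} {Fin.zero ∷ map Fin.suc R} {R} λ { (there p) → suc∈map⁻ p })
  part₀ : ∀ R → without-zero R ≤ has c R * lift φ R
  part₀ R = *-monoˡ-≤ (lift φ R) (has-mono {c = Fin.suc c} {c} {map Fin.suc R} {R} suc∈map⁻)
  rest : ∀ s → ∑Sub (suc n) (suc s) without-zero ≤ ∑Sub n s (lift φ ∘ map (punchIn c))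
  rest s = ≤-trans (∑-mono (subsetsOfSize (suc n) (suc s)) part₀) (∑Sub-∋ n s c mono₀)
  go : ∀ s → ∑Sub (suc n) s with-zero + ∑Sub (suc n) (suc s) without-zero
             ≤ ∑Sub (suc n) s (φ ∘ map (punchIn (Fin.suc c)))
  -- The sets that contain zero have s further elements; for s = 0 there is no room for c among them
  -- and their sum vanishes.
  go zero = begin
    ∑Sub (suc n) 0 with-zero + ∑Sub (suc n) 1 without-zero
      ≤⟨ +-mono-≤ (≤-reflexive (trans (∑Sub-0 (suc n) with-zero)
           (cong (_* prepend φ []) (has-∉ {c = Fin.suc c} {Fin.zero ∷ []} λ { (here ()) ; (there ()) })))) (rest 0) ⟩
    ∑Sub n 0 (lift φ ∘ map (punchIn c))             ≡⟨ ∑Sub-0 n (lift φ ∘ map (punchIn c)) ⟩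
    φ []                                            ≡⟨ sym (∑Sub-0 (suc n) (φ ∘ map (punchIn (Fin.suc c)))) ⟩
    ∑Sub (suc n) 0 (φ ∘ map (punchIn (Fin.suc c)))  ∎
  go (suc s) = begin
    ∑Sub (suc n) (suc s) with-zero + ∑Sub (suc n) (suc (suc s)) without-zero
      ≤⟨ +-mono-≤ (≤-trans (∑-mono (subsetsOfSize (suc n) (suc s)) part₁) (∑Sub-∋ n s c mono₁)) (rest (suc s)) ⟩
    ∑Sub n s (prepend φ ∘ map (punchIn c)) + ∑Sub n (suc s) (lift φ ∘ map (punchIn c))
      ≡⟨ sym (∑Sub-punchIn-suc n s c φ) ⟩
    ∑Sub (suc n) (suc s) (φ ∘ map (punchIn (Fin.suc c))) ∎

-- Membership of c is traded for its absence: for |R| = s the event c ∈ R has weight s/d, and the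
-- average of φ over subsets of [d] ∖ {c} only grows when the size is raised from s − 1 to S.
∑Sub-exchange : ∀ d s S (c : Fin d) {φ : List (Fin d) → ℕ} → MonotoneAwayFrom c φ →
                0 < s → s ≤ S → S < d →
                ((d ∸ S) * choose d S) * ∑Sub d s (λ R → has c R * φ R)
                ≤ (s * choose d s) * ∑Sub d S (λ R → misses c R * φ R)
∑Sub-exchange (suc n) (suc s) S c {φ} mono _ s<S (s≤s S≤n) = begin
  ((suc n ∸ S) * choose (suc n) S) * ∑Sub (suc n) (suc s) (λ R → has c R * φ R)
    ≤⟨ *-mono-≤ (≤-reflexive out) (∑Sub-∋ n s c mono) ⟩
  (suc n * choose n S) * e s     ≡⟨ *-assoc (suc n) (choose n S) (e s) ⟩
  suc n * (choose n S * e s)     ≤⟨ *-monoʳ-≤ (suc n) avg ⟩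
  suc n * (choose n s * e S)     ≡⟨ sym (*-assoc (suc n) (choose n s) (e S)) ⟩
  (suc n * choose n s) * e S     ≡⟨ cong₂ _*_ (sym (absorption n s)) (sym (∑Sub-∌ n S c φ)) ⟩
  (suc s * choose (suc n) (suc s)) * ∑Sub (suc n) S (λ R → misses c R * φ R) ∎
  where
  open ≤-Reasoning
  e : ℕ → ℕ
  e t = ∑Sub n t (φ ∘ map (punchIn c))
  avoid : Monotone (φ ∘ map (punchIn c))
  avoid R⊆ = mono (λ b _ → map-⊆ (punchIn c) R⊆)
  avg : choose n S * e s ≤ choose n s * e S
  avg = subst (λ t → choose n t * e s ≤ choose n s * e t) (m∸n+n≡m (<⇒≤ s<S))
    (∑Sub-avg-mono n s (S ∸ s) avoid (≤-trans (≤-reflexive (m∸n+n≡m (<⇒≤ s<S))) S≤n))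
  out : (suc n ∸ S) * choose (suc n) S ≡ suc n * choose n S
  out = trans (*-distribʳ-∸ (choose (suc n) S) (suc n) S)
    (trans (cong (_∸ S * choose (suc n) S) (absorption′ n S)) (m+n∸n≡m _ (S * choose (suc n) S)))

subset-length : ∀ n s → All (λ R → length R ≡ s) (subsetsOfSize n s)
subset-length zero    zero    = refl ∷ []
subset-length zero    (suc s) = []
subset-length (suc n) zero    = refl ∷ []
subset-length (suc n) (suc s) = AllP.++⁺
  (AllP.map⁺ (All.map (λ {R} e → cong suc (trans (length-map Fin.suc R) e)) (subset-length n s)))
  (AllP.map⁺ (All.map (λ {R} e → trans (length-map Fin.suc R) e) (subset-length n (suc s))))

subset-unique : ∀ n s → All Unique (subsetsOfSize n s)
subset-unique zero    zero    = [] ∷ []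
subset-unique zero    (suc s) = []
subset-unique (suc n) zero    = [] ∷ []
subset-unique (suc n) (suc s) = AllP.++⁺
  (AllP.map⁺ (All.map (λ {R} u → AllP.map⁺ (All.universal (λ _ ()) R) ∷ UniqueP.map⁺ FinP.suc-injective u)
                      (subset-unique n s)))
  (AllP.map⁺ (All.map (UniqueP.map⁺ FinP.suc-injective) (subset-unique n (suc s))))

-- The sum over the levels k.

4^≡2^*2^ : ∀ k → 4 ^ k ≡ 2 ^ k * 2 ^ k
4^≡2^*2^ zero    = refl
4^≡2^*2^ (suc k) = trans (cong (4 *_) (4^≡2^*2^ k)) (regroup (2 ^ k))
  where
  regroup : ∀ u → 4 * (u * u) ≡ (2 * u) * (2 * u)
  regroup = solve-∀

-- Unrolled, this is 2^K times the sum of min(4^k, n²) / 2^k over 1 ≤ k ≤ K, kept integral by the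
-- recursion.
geometric : ℕ → ℕ → ℕ
geometric n zero    = 0
geometric n (suc K) = 2 * geometric n K + (4 ^ suc K) ⊓ (n * n)

-- With u = 2 ^ K: while 2u ≤ n the terms 4 ^ k dominate, afterwards the terms n².
geometric-invariant : ∀ n K → (2 * 2 ^ K ≤ n × geometric n K ≤ 2 * (2 ^ K * 2 ^ K))
                            ⊎ (geometric n K + n * n ≤ 4 * (n * 2 ^ K))
geometric-invariant zero          zero = inj₂ z≤n
geometric-invariant (suc zero)    zero = inj₂ (s≤s z≤n)
geometric-invariant (suc (suc n)) zero = inj₁ (s≤s (s≤s z≤n) , z≤n)
geometric-invariant n (suc K) with geometric-invariant n K
-- Doubling yields two copies of n²: one pays for the new term, the other restores the invariant.
... | inj₂ le = inj₂ (begin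
  2 * t + q ⊓ (n * n) + n * n  ≤⟨ +-monoˡ-≤ (n * n) (+-monoʳ-≤ (2 * t) (m⊓n≤n q (n * n))) ⟩
  2 * t + n * n + n * n        ≡⟨ double t n ⟩
  2 * (t + n * n)              ≤⟨ *-monoʳ-≤ 2 le ⟩
  2 * (4 * (n * u))            ≡⟨ swap n u ⟩
  4 * (n * (2 * u))            ∎)
  where
  open ≤-Reasoning
  u = 2 ^ K
  t = geometric n K
  q = 4 ^ suc K
  double : ∀ t n → 2 * t + n * n + n * n ≡ 2 * (t + n * n)
  double = solve-∀
  swap : ∀ n u → 2 * (4 * (n * u)) ≡ 4 * (n * (2 * u))
  swap = solve-∀
... | inj₁ (2u≤n , le) = case ≤-total (2 * (2 * u)) n of λ where
    (inj₁ small) → inj₁ (small , bound)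
    -- The crossing point 2u ≤ n ≤ 4u: the first inequality converts the quadratic bound into one
    -- linear in n, the second bounds the additional n².
    (inj₂ large) → inj₂ (begin
      2 * t + q ⊓ (n * n) + n * n                          ≤⟨ +-monoˡ-≤ (n * n) bound ⟩
      2 * ((2 * u) * (2 * u)) + n * n                      ≤⟨ +-mono-≤ (*-monoʳ-≤ 2 (*-monoˡ-≤ (2 * u) 2u≤n)) (*-monoʳ-≤ n large) ⟩
      2 * (n * (2 * u)) + n * (2 * (2 * u))                ≡⟨ collect n u ⟩
      4 * (n * (2 * u))                                    ∎)
  where
  open ≤-Reasoning
  u = 2 ^ K
  t = geometric n K
  q = 4 ^ suc K
  bound : 2 * t + q ⊓ (n * n) ≤ 2 * ((2 * u) * (2 * u))
  bound = begin
    2 * t + q ⊓ (n * n)            ≤⟨ +-mono-≤ (*-monoʳ-≤ 2 le) (≤-trans (m⊓n≤m q (n * n)) (≤-reflexive (4^≡2^*2^ (suc K)))) ⟩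
    2 * (2 * (u * u)) + (2 * u) * (2 * u) ≡⟨ e u ⟩
    2 * ((2 * u) * (2 * u))        ∎
    where e : ∀ u → 2 * (2 * (u * u)) + (2 * u) * (2 * u) ≡ 2 * ((2 * u) * (2 * u))
          e = solve-∀
  collect : ∀ n u → 2 * (n * (2 * u)) + n * (2 * (2 * u)) ≡ 4 * (n * (2 * u))
  collect = solve-∀

geometric-bound : ∀ n K → geometric n K ≤ 4 * (n * 2 ^ K)
geometric-bound n K with geometric-invariant n K
... | inj₂ le = ≤-trans (m≤m+n _ (n * n)) le
... | inj₁ (2u≤n , le) = begin
  geometric n K        ≤⟨ le ⟩
  2 * (u * u)          ≡⟨ sym (*-assoc 2 u u) ⟩
  (2 * u) * u          ≤⟨ *-monoˡ-≤ u 2u≤n ⟩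
  n * u                ≤⟨ m≤m+n (n * u) _ ⟩
  4 * (n * u)          ∎
  where
  open ≤-Reasoning
  u = 2 ^ K

levels : ℕ → List ℕ
levels K = map suc (upTo K)

∑-levels-suc : ∀ K (f : ℕ → ℕ) → ∑ (levels (suc K)) f ≡ ∑ (levels K) f + f (suc K)
∑-levels-suc K f = trans (cong (λ xs → ∑ (map suc xs) f) (sym (upTo-∷ʳ K)))
  (trans (cong (λ xs → ∑ xs f) (map-++ suc (upTo K) (K ∷ [])))
  (trans (∑-++ (levels K) (suc K ∷ []) f) (cong (_+_ (∑ (levels K) f)) (+-identityʳ (f (suc K))))))

∈-levels : ∀ K {k} → k ∈ levels K → 0 < k × k ≤ K
∈-levels zero    ()
∈-levels (suc K) {k} k∈ with ∈-++⁻ (levels K) (subst (k ∈_)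
  (trans (cong (map suc) (sym (upTo-∷ʳ K))) (map-++ suc (upTo K) (K ∷ []))) k∈)
... | inj₁ p = proj₁ (∈-levels K p) , m≤n⇒m≤1+n (proj₂ (∈-levels K p))
... | inj₂ (here refl) = s≤s z≤n , ≤-refl

∑-levels-geometric : ∀ n K → ∑ (levels K) (λ k → 2 ^ (K ∸ k) * ((4 ^ k) ⊓ (n * n))) ≡ geometric n K
∑-levels-geometric n zero    = refl
∑-levels-geometric n (suc K) = begin
  ∑ (levels (suc K)) _         ≡⟨ ∑-levels-suc K _ ⟩
  ∑ (levels K) _ + 2 ^ (K ∸ K) * q ≡⟨ cong₂ _+_ (∑-cong-levels) (cong (λ z → 2 ^ z * q) (n∸n≡0 K)) ⟩
  ∑ (levels K) (λ k → 2 * (2 ^ (K ∸ k) * g k)) + 1 * q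
        ≡⟨ cong₂ _+_ (trans (∑-*ˡ (levels K) 2 _) (cong (2 *_) (∑-levels-geometric n K))) (*-identityˡ q) ⟩
  geometric n (suc K)          ∎
  where
  open ≡-Reasoning
  g : ℕ → ℕ
  g k = (4 ^ k) ⊓ (n * n)
  q = g (suc K)
  term : ∀ k → k ∈ levels K → 2 ^ (suc K ∸ k) * g k ≡ 2 * (2 ^ (K ∸ k) * g k)
  term k k∈ = trans (cong (λ z → 2 ^ z * g k) (+-∸-assoc 1 (proj₂ (∈-levels K k∈))))
                    (*-assoc 2 (2 ^ (K ∸ k)) (g k))
  ∑-cong-levels : ∑ (levels K) (λ k → 2 ^ (suc K ∸ k) * g k) ≡ ∑ (levels K) (λ k → 2 * (2 ^ (K ∸ k) * g k))
  ∑-cong-levels = ≤-antisym (∑-mono-∈ (levels K) (λ k k∈ → ≤-reflexive (term k k∈)))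
                            (∑-mono-∈ (levels K) (λ k k∈ → ≤-reflexive (sym (term k k∈))))

-- Independent uniform values in a finite set.

∑-allFuns-suc : ∀ n (xs : List A) (f : (Fin (suc n) → A) → ℕ) →
                ∑ (allFuns (suc n) xs) f ≡ ∑ xs (λ a → ∑ (allFuns n xs) (λ r → f (a VF.∷ r)))
∑-allFuns-suc n xs f = trans (∑-concatMap _ xs f) (∑-cong xs (λ a → ∑-map _ (allFuns n xs) f))

length-allFuns : ∀ n (xs : List A) → length (allFuns n xs) ≡ length xs ^ n
length-allFuns zero    xs = refl
length-allFuns (suc n) xs = begin
  length (allFuns (suc n) xs)                    ≡⟨ trans (sym (*-identityʳ _)) (sym (∑-const (allFuns (suc n) xs) 1)) ⟩
  ∑ (allFuns (suc n) xs) (λ _ → 1)               ≡⟨ ∑-allFuns-suc n xs _ ⟩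
  ∑ xs (λ _ → ∑ (allFuns n xs) (λ _ → 1))        ≡⟨ ∑-const xs _ ⟩
  length xs * ∑ (allFuns n xs) (λ _ → 1)         ≡⟨ cong (length xs *_) (trans (∑-const (allFuns n xs) 1) (*-identityʳ _)) ⟩
  length xs * length (allFuns n xs)              ≡⟨ cong (length xs *_) (length-allFuns n xs) ⟩
  length xs ^ suc n                              ∎
  where open ≡-Reasoning

allFuns-∈ : ∀ n (xs : List A) → All (λ r → ∀ i → r i ∈ xs) (allFuns n xs)
allFuns-∈ zero    xs = (λ ()) ∷ []
allFuns-∈ (suc n) xs = AllP.concat⁺ (AllP.map⁺ (All.tabulate (λ {a} a∈ →
  AllP.map⁺ (All.map (λ h → λ { Fin.zero → a∈ ; (Fin.suc i) → h i }) (allFuns-∈ n xs)))))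

module _ {R : List (Fin n)} (u : Unique R) (c : Fin n) where
  private s = length R

  -- A value uniform among s distinct elements equals c with probability at most 1/s. The inequality
  -- allows for c outside R.
  ∑-hit : ∀ a (i : Fin a) → s * ∑ (allFuns a R) (λ r → ind (r i FinP.≟ c)) ≤ s ^ a
  ∑-hit (suc a) Fin.zero = begin
    s * ∑ (allFuns (suc a) R) _                      ≡⟨ cong (s *_) (∑-allFuns-suc a R _) ⟩
    s * ∑ R (λ v → ∑ (allFuns a R) (λ _ → ind (v FinP.≟ c)))
        ≡⟨ cong (s *_) (∑-cong R (λ v → trans (∑-const (allFuns a R) _) (cong (_* ind (v FinP.≟ c)) (length-allFuns a R)))) ⟩
    s * ∑ R (λ v → s ^ a * ind (v FinP.≟ c))         ≡⟨ cong (s *_) (∑-*ˡ R (s ^ a) _) ⟩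
    s * (s ^ a * ∑ R (λ v → ind (v FinP.≟ c)))       ≤⟨ *-monoʳ-≤ s (*-monoʳ-≤ (s ^ a) (∑-ind-≡ FinP._≟_ u c)) ⟩
    s * (s ^ a * 1)                                  ≡⟨ cong (s *_) (*-identityʳ (s ^ a)) ⟩
    s ^ suc a                                        ∎
    where open ≤-Reasoning
  ∑-hit (suc a) (Fin.suc i) = begin
    s * ∑ (allFuns (suc a) R) _                      ≡⟨ cong (s *_) (trans (∑-allFuns-suc a R _) (∑-const R _)) ⟩
    s * (s * ∑ (allFuns a R) (λ r → ind (r i FinP.≟ c))) ≤⟨ *-monoʳ-≤ s (∑-hit a i) ⟩
    s ^ suc a                                        ∎
    where open ≤-Reasoning

  hit₂ : ∀ {a} (i j : Fin a) → (Fin a → Fin n) → ℕ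
  hit₂ i j r = ind (r i FinP.≟ c) * ind (r j FinP.≟ c)

  -- Distinct positions carry independent values, whence the probability 1/s². Common leading
  -- positions are peeled off until one of the two is zero; that case conditions on the first value
  -- and uses `∑-hit` for the other.
  ∑-hit₂ : ∀ a (i j : Fin a) → i ≢ j → (s * s) * ∑ (allFuns a R) (hit₂ i j) ≤ s ^ a
  ∑-hit₂-zero : ∀ a (j : Fin a) → (s * s) * ∑ (allFuns (suc a) R) (hit₂ Fin.zero (Fin.suc j)) ≤ s ^ suc a
  ∑-hit₂-zero a j = begin
    (s * s) * ∑ (allFuns (suc a) R) _     ≡⟨ cong ((s * s) *_) (∑-allFuns-suc a R _) ⟩
    (s * s) * ∑ R (λ v → ∑ (allFuns a R) (λ r → ind (v FinP.≟ c) * ind (r j FinP.≟ c)))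
       ≡⟨ cong ((s * s) *_) (∑-cong R (λ v → trans (∑-*ˡ (allFuns a R) (ind (v FinP.≟ c)) _) (*-comm (ind (v FinP.≟ c)) h))) ⟩
    (s * s) * ∑ R (λ v → h * ind (v FinP.≟ c)) ≡⟨ cong ((s * s) *_) (∑-*ˡ R h _) ⟩
    (s * s) * (h * ∑ R (λ v → ind (v FinP.≟ c))) ≤⟨ *-monoʳ-≤ (s * s) (*-monoʳ-≤ h (∑-ind-≡ FinP._≟_ u c)) ⟩
    (s * s) * (h * 1)                     ≡⟨ trans (cong ((s * s) *_) (*-identityʳ h)) (*-assoc s s h) ⟩
    s * (s * h)                           ≤⟨ *-monoʳ-≤ s (∑-hit a j) ⟩
    s ^ suc a                             ∎
    where
    open ≤-Reasoning
    h = ∑ (allFuns a R) (λ r → ind (r j FinP.≟ c))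
  ∑-hit₂ (suc a) Fin.zero    Fin.zero    i≢j = contradiction refl i≢j
  ∑-hit₂ (suc a) Fin.zero    (Fin.suc j) i≢j = ∑-hit₂-zero a j
  ∑-hit₂ (suc a) (Fin.suc i) Fin.zero    i≢j = ≤-trans
    (≤-reflexive (cong ((s * s) *_) (∑-cong (allFuns (suc a) R)
      (λ r → *-comm (ind (r (Fin.suc i) FinP.≟ c)) (ind (r Fin.zero FinP.≟ c))))))
    (∑-hit₂-zero a i)
  ∑-hit₂ (suc a) (Fin.suc i) (Fin.suc j) i≢j = begin
    (s * s) * ∑ (allFuns (suc a) R) _     ≡⟨ cong ((s * s) *_) (trans (∑-allFuns-suc a R _) (∑-const R _)) ⟩
    (s * s) * (s * ∑ (allFuns a R) (hit₂ i j)) ≡⟨ trans (sym (*-assoc (s * s) s _)) (trans (cong (_* ∑ (allFuns a R) (hit₂ i j)) (*-comm (s * s) s)) (*-assoc s (s * s) _)) ⟩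
    s * ((s * s) * ∑ (allFuns a R) (hit₂ i j)) ≤⟨ *-monoʳ-≤ s (∑-hit₂ a i j (λ e → i≢j (cong Fin.suc e))) ⟩
    s ^ suc a                             ∎
    where open ≤-Reasoning

-- Uniform signs

_[_≔_] : (Fin n → Bool) → Fin n → Bool → (Fin n → Bool)
α [ c ≔ v ] = updateAt α c (λ _ → v)

∑Bool : ∀ n → ((Fin n → Bool) → ℕ) → ℕ
∑Bool n = ∑ (allFuns n bools)

-- Sign vectors are functions, for which pointwise equality does not yield propositional equality;
-- the summands have to respect it explicitly.
Respects≗ : ((Fin n → Bool) → ℕ) → Set
Respects≗ g = ∀ α β → (∀ i → α i ≡ β i) → g α ≡ g β

∑-bools : ∀ (f : Bool → ℕ) → ∑ bools f ≡ f true + f false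
∑-bools f = cong (_+_ (f true)) (+-identityʳ (f false))

∷-cong : ∀ v {α β : Fin n → Bool} → (∀ i → α i ≡ β i) → ∀ i → (v VF.∷ α) i ≡ (v VF.∷ β) i
∷-cong v h Fin.zero    = refl
∷-cong v h (Fin.suc i) = h i

∑Bool-suc : ∀ n (g : (Fin (suc n) → Bool) → ℕ) →
            ∑Bool (suc n) g ≡ ∑Bool n (λ α → g (true VF.∷ α)) + ∑Bool n (λ α → g (false VF.∷ α))
∑Bool-suc n g = trans (∑-allFuns-suc n bools g) (∑-bools (λ v → ∑Bool n (λ α → g (v VF.∷ α))))

-- Each β arises exactly twice on the right: in the sum that writes `β c` at position c, from the
-- two α that agree with β elsewhere.
resample : ∀ n (c : Fin n) (g : (Fin n → Bool) → ℕ) → Respects≗ g →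
           2 * ∑Bool n g ≡ ∑Bool n (λ α → g (α [ c ≔ true ])) + ∑Bool n (λ α → g (α [ c ≔ false ]))
resample (suc n) Fin.zero g ext = begin
  2 * ∑Bool (suc n) g                            ≡⟨ cong (2 *_) (∑Bool-suc n g) ⟩
  2 * (x + y)                                    ≡⟨ r x y ⟩
  (x + x) + (y + y)                              ≡⟨ sym (cong₂ _+_ (half true) (half false)) ⟩
  ∑Bool (suc n) (λ α → g (α [ Fin.zero ≔ true ]))
    + ∑Bool (suc n) (λ α → g (α [ Fin.zero ≔ false ])) ∎
  where
  open ≡-Reasoning
  x = ∑Bool n (λ α → g (true VF.∷ α))
  y = ∑Bool n (λ α → g (false VF.∷ α))
  r : ∀ x y → 2 * (x + y) ≡ (x + x) + (y + y)
  r = solve-∀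
  half : ∀ v → ∑Bool (suc n) (λ α → g (α [ Fin.zero ≔ v ])) ≡
               ∑Bool n (λ α → g (v VF.∷ α)) + ∑Bool n (λ α → g (v VF.∷ α))
  half v = trans (∑Bool-suc n _) (cong₂ _+_
    (∑-cong (allFuns n bools) (λ α → ext _ _ λ { Fin.zero → refl ; (Fin.suc i) → refl }))
    (∑-cong (allFuns n bools) (λ α → ext _ _ λ { Fin.zero → refl ; (Fin.suc i) → refl })))
resample (suc n) (Fin.suc c) g ext = begin
  2 * ∑Bool (suc n) g                                ≡⟨ cong (2 *_) (∑Bool-suc n g) ⟩
  2 * (∑Bool n (slice true) + ∑Bool n (slice false)) ≡⟨ *-distribˡ-+ 2 (∑Bool n (slice true)) _ ⟩
  2 * ∑Bool n (slice true) + 2 * ∑Bool n (slice false)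
     ≡⟨ cong₂ _+_ (resample n c (slice true) (slice-ext true)) (resample n c (slice false) (slice-ext false)) ⟩
  (p true true + p true false) + (p false true + p false false)
     ≡⟨ shuffle (p true true) (p true false) (p false true) (p false false) ⟩
  (p true true + p false true) + (p true false + p false false)
     ≡⟨ sym (cong₂ _+_ (whole true) (whole false)) ⟩
  ∑Bool (suc n) (λ α → g (α [ Fin.suc c ≔ true ]))
    + ∑Bool (suc n) (λ α → g (α [ Fin.suc c ≔ false ])) ∎
  where
  open ≡-Reasoning
  slice : Bool → (Fin n → Bool) → ℕ
  slice w α = g (w VF.∷ α)
  slice-ext : ∀ w → Respects≗ (slice w)
  slice-ext w α β h = ext _ _ (∷-cong w h)
  p : Bool → Bool → ℕ
  p w v = ∑Bool n (λ α → slice w (α [ c ≔ v ]))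
  shuffle : ∀ a b c d → (a + b) + (c + d) ≡ (a + c) + (b + d)
  shuffle = solve-∀
  push : ∀ w v → ∑Bool n (λ α → g ((w VF.∷ α) [ Fin.suc c ≔ v ])) ≡ p w v
  push w v = ∑-cong (allFuns n bools) (λ α → ext _ _ λ { Fin.zero → refl ; (Fin.suc i) → refl })
  whole : ∀ v → ∑Bool (suc n) (λ α → g (α [ Fin.suc c ≔ v ])) ≡ p true v + p false v
  whole v = trans (∑Bool-suc n _) (cong₂ _+_ (push true v) (push false v))

DependsOnlyOn : (Fin n → Set) → ((Fin n → Bool) → ℕ) → Set
DependsOnlyOn I g = ∀ α β → (∀ i → I i → α i ≡ β i) → g α ≡ g β

-- Uniform bits read through a map ρ that is injective on I are jointly uniform on I.
∑Bool-pullback : ∀ a b (I : Fin a → Set) → (∀ i → Dec (I i)) → (ρ : Fin a → Fin b) →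
  (∀ i j → I i → I j → ρ i ≡ ρ j → i ≡ j) →
  (g : (Fin a → Bool) → ℕ) → DependsOnlyOn I g →
  2 ^ b * ∑Bool a g ≡ 2 ^ a * ∑Bool b (λ α → g (α ∘ ρ))
∑Bool-pullback zero b I I? ρ inj g dep = begin
  2 ^ b * ∑Bool 0 g                     ≡⟨ cong (2 ^ b *_) (trans (+-identityʳ _) (dep _ empty λ ())) ⟩
  2 ^ b * g empty                       ≡⟨ cong (_* g empty) (sym (length-allFuns b bools)) ⟩
  length (allFuns b bools) * g empty    ≡⟨ sym (∑-const (allFuns b bools) (g empty)) ⟩
  ∑Bool b (λ _ → g empty)               ≡⟨ ∑-cong (allFuns b bools) (λ α → dep empty (α ∘ ρ) λ ()) ⟩
  ∑Bool b (λ α → g (α ∘ ρ))             ≡⟨ sym (*-identityˡ _) ⟩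
  1 * ∑Bool b (λ α → g (α ∘ ρ))         ∎
  where
  open ≡-Reasoning
  empty : Fin 0 → Bool
  empty ()
∑Bool-pullback (suc a) b I I? ρ inj g dep = begin
  2 ^ b * ∑Bool (suc a) g                            ≡⟨ cong (2 ^ b *_) (∑Bool-suc a g) ⟩
  2 ^ b * (∑Bool a (slice true) + ∑Bool a (slice false)) ≡⟨ *-distribˡ-+ (2 ^ b) (∑Bool a (slice true)) _ ⟩
  2 ^ b * ∑Bool a (slice true) + 2 ^ b * ∑Bool a (slice false)
    ≡⟨ cong₂ _+_ (ih true) (ih false) ⟩
  2 ^ a * q true + 2 ^ a * q false                   ≡⟨ sym (*-distribˡ-+ (2 ^ a) (q true) (q false)) ⟩
  2 ^ a * (q true + q false)                         ≡⟨ cong (2 ^ a *_) merge ⟩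
  2 ^ a * (2 * ∑Bool b (λ α → g (α ∘ ρ)))            ≡⟨ trans (sym (*-assoc (2 ^ a) 2 _)) (cong (_* ∑Bool b (λ α → g (α ∘ ρ))) (*-comm (2 ^ a) 2)) ⟩
  2 ^ suc a * ∑Bool b (λ α → g (α ∘ ρ))              ∎
  where
  open ≡-Reasoning
  slice : Bool → (Fin a → Bool) → ℕ
  slice v β = g (v VF.∷ β)
  q : Bool → ℕ
  q v = ∑Bool b (λ α → slice v (α ∘ ρ ∘ Fin.suc))
  ih : ∀ v → 2 ^ b * ∑Bool a (slice v) ≡ 2 ^ a * q v
  ih v = ∑Bool-pullback a b (I ∘ Fin.suc) (I? ∘ Fin.suc) (ρ ∘ Fin.suc)
    (λ i j Ii Ij e → FinP.suc-injective (inj _ _ Ii Ij e)) (slice v)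
    (λ α β h → dep _ _ λ { Fin.zero _ → refl ; (Fin.suc i) Ii → h i Ii })
  c = ρ Fin.zero
  full-ext : Respects≗ (λ α → g (α ∘ ρ))
  full-ext α β h = dep _ _ (λ i _ → h (ρ i))
  merge : q true + q false ≡ 2 * ∑Bool b (λ α → g (α ∘ ρ))
  merge with I? Fin.zero
  -- Injectivity keeps the other indices of I away from c, so overwriting bit c of α changes, among
  -- the arguments that g reads, only the first one.
  ... | yes I0 = sym (trans (resample b c _ full-ext) (cong₂ _+_ (upd true) (upd false)))
    where
    upd : ∀ v → ∑Bool b (λ α → g ((α [ c ≔ v ]) ∘ ρ)) ≡ q v
    upd v = ∑-cong (allFuns b bools) (λ α → dep _ _ λ where
      Fin.zero    _  → VFP.updateAt-updates c α
      (Fin.suc i) Ii → VFP.updateAt-minimal (ρ (Fin.suc i)) c α (λ e → case inj _ _ Ii I0 e of λ ()))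
  ... | no ¬I0 = trans (cong₂ _+_ (same true) (same false))
    (cong (_+_ (∑Bool b (λ α → g (α ∘ ρ)))) (sym (+-identityʳ (∑Bool b (λ α → g (α ∘ ρ))))))
    where
    same : ∀ v → q v ≡ ∑Bool b (λ α → g (α ∘ ρ))
    same v = ∑-cong (allFuns b bools) (λ α → dep _ _ λ where
      Fin.zero    I0 → contradiction I0 ¬I0
      (Fin.suc i) _  → refl)

-- Relevant coordinates and collisions

module Relevance {X : Set} {d : ℕ} (part : X → Fin d) (coord : X → Fin d → Bool) where

  -- Meant for c = r_i: above c only the plain sum contributes to the value, and it omits R, so
  -- coordinates of R may differ freely.
  Agree : List (Fin d) → Fin d → X → X → Set
  Agree R c x y = ∀ b → toℕ c < toℕ b → b ∈ R ⊎ coord x b ≡ coord y b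

  Splits : List (Fin d) → Fin d → Fin d → X → X → Set
  Splits R i c x y = (part x ≡ i × part y ≡ i) × coord x c ≢ coord y c × Agree R c x y

  -- The sign attached to part i can influence the graph on Q only if r_i satisfies Relevant Q R i.
  Relevant : List X → List (Fin d) → Fin d → Fin d → Set
  Relevant Q R i c = Any (λ x → Any (Splits R i c x) Q) Q

  agree? : ∀ R c x y → Dec (Agree R c x y)
  agree? R c x y = FinP.all? λ b → (toℕ c <? toℕ b) →-dec ((R ∋? b) ⊎-dec (coord x b BoolP.≟ coord y b))

  splits? : ∀ R i c x y → Dec (Splits R i c x y)
  splits? R i c x y = ((part x FinP.≟ i) ×-dec (part y FinP.≟ i))
    ×-dec (¬? (coord x c BoolP.≟ coord y c) ×-dec agree? R c x y)

  relevant? : ∀ Q R i c → Dec (Relevant Q R i c)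
  relevant? Q R i c = Any.any? (λ x → Any.any? (splits? R i c x) Q) Q

  relevant⁺ : ∀ {Q R i c x y} → x ∈ Q → y ∈ Q → Splits R i c x y → Relevant Q R i c
  relevant⁺ x∈ y∈ s = lose x∈ (lose y∈ s)

  relevant⁻ : ∀ {Q R i c} → Relevant Q R i c → ∃ λ x → ∃ λ y → x ∈ Q × y ∈ Q × Splits R i c x y
  relevant⁻ rel with find rel
  ... | x , x∈ , rel′ with find rel′
  ... | y , y∈ , s = x , y , x∈ , y∈ , s

  -- A larger R exempts more coordinates from agreement, and agreement is demanded only strictly
  -- above c, so the membership of c itself has no influence. This makes `capped` monotone away from
  -- c.
  relevant-mono : ∀ {Q R R′ i c} → (∀ b → b ≢ c → b ∈ R → b ∈ R′) → Relevant Q R i c → Relevant Q R′ i c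
  relevant-mono {Q} {R} {R′} {i} {c} h = Any.map (Any.map λ (p , q , agree) → p , q , λ b c<b → case agree b c<b of λ where
    (inj₁ b∈) → inj₁ (h b (λ { refl → <-irrefl refl c<b }) b∈)
    (inj₂ e)  → inj₂ e)

  relevants : List X → List (Fin d) → Fin d → ℕ
  relevants Q R c = ∑ (allFin d) (λ i → ind (relevant? Q R i c))

  splits-sym : ∀ {R i c x y} → Splits R i c x y → Splits R i c y x
  splits-sym ((p , q) , ne , agree) = (q , p) , (λ e → ne (sym e)) , λ b c<b → case agree b c<b of λ where
    (inj₁ b∈) → inj₁ b∈
    (inj₂ e)  → inj₂ (sym e)

  New : X → List X → List (Fin d) → Fin d → Fin d → Set
  New z Q R c i = (c ∉ R × Relevant (z ∷ Q) R i c) × ¬ Relevant Q R i c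

  new? : ∀ z Q R c i → Dec (New z Q R c i)
  new? z Q R c i = (¬? (R ∋? c) ×-dec relevant? (z ∷ Q) R i c) ×-dec ¬? (relevant? Q R i c)

  -- z does not split from itself, and two old points that split would have made c relevant before;
  -- so the witnesses are z and an old point.
  new-partner : ∀ {z Q R c i} → New z Q R c i → ∃ λ y → y ∈ Q × Splits R i c z y
  new-partner ((_ , rel) , ¬rel) with relevant⁻ rel
  ... | x , y , here refl , here refl , (_ , ne , _) = contradiction refl ne
  ... | x , y , here refl , there y∈  , s = y , y∈ , s
  ... | x , y , there x∈  , here refl , s = x , x∈ , splits-sym s
  ... | x , y , there x∈  , there y∈  , s = contradiction (relevant⁺ x∈ y∈ s) ¬rel

  new-part : ∀ {z Q R c i} → New z Q R c i → part z ≡ i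
  new-part new = proj₁ (proj₁ (proj₂ (proj₂ (new-partner new))))

  -- If z splits from y at c and from y′ at a larger c′, then y and y′ already split at c′.
  new-≮ : ∀ {z Q R c c′ i i′} → New z Q R c i → New z Q R c′ i′ → ¬ (toℕ c < toℕ c′)
  new-≮ {c′ = c′} new new′@((c′∉ , _) , ¬rel′) c<c′ with new-partner new | new-partner new′
  ... | y , y∈ , (zi , yi) , _ , agree | y′ , y′∈ , (zi′ , yi′) , ne′ , agree′ =
    ¬rel′ (relevant⁺ y∈ y′∈ ((trans yi (trans (sym zi) zi′) , yi′) , ne , above))
    where
    ne : coord y c′ ≢ coord y′ c′
    ne e with agree c′ c<c′
    ... | inj₁ c′∈ = c′∉ c′∈
    ... | inj₂ e′  = ne′ (trans e′ e)
    above : ∀ b → toℕ c′ < toℕ b → b ∈ _ ⊎ coord y b ≡ coord y′ b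
    above b c′<b with agree b (<-trans c<c′ c′<b) | agree′ b c′<b
    ... | inj₁ b∈ | _       = inj₁ b∈
    ... | inj₂ _  | inj₁ b∈ = inj₁ b∈
    ... | inj₂ e  | inj₂ e′ = inj₂ (trans (sym e) e′)

  new-unique : ∀ {z Q R c c′ i i′} → New z Q R c i → New z Q R c′ i′ → c ≡ c′
  new-unique {c = c} {c′} new new′ with <-cmp (toℕ c) (toℕ c′)
  ... | tri< lt _ _ = contradiction lt (new-≮ new new′)
  ... | tri≈ _ e _  = FinP.toℕ-injective e
  ... | tri> _ _ gt = contradiction gt (new-≮ new′ new)

  -- Off R, the points of a cell form a binary trie read from the highest coordinate down, and an
  -- inserted point leaves the existing trie at one level at most. Formally, a new pair has i =
  -- `part z` by `new-part`, and its c is unique by `new-unique`.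
  ∑-relevants : ∀ Q R → ∑ (allFin d) (λ c → misses c R * relevants Q R c) ≤ length Q
  ∑-relevants [] R = ≤-reflexive (∑-zero (allFin d) _ λ c _ →
    trans (cong (misses c R *_) (∑-zero (allFin d) _ λ i _ → refl)) (*-zeroʳ (misses c R)))
  ∑-relevants (z ∷ Q) R = begin
    ∑ (allFin d) (λ c → misses c R * relevants (z ∷ Q) R c)
      ≤⟨ ∑-mono (allFin d) column ⟩
    ∑ (allFin d) (λ c → news c + misses c R * relevants Q R c)
      ≡⟨ ∑-+ (allFin d) news _ ⟩
    ∑ (allFin d) news + ∑ (allFin d) (λ c → misses c R * relevants Q R c)
      ≤⟨ +-mono-≤ one (∑-relevants Q R) ⟩
    suc (length Q) ∎
    where
    open ≤-Reasoning
    new : Fin d → Fin d → ℕ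
    new c i = ind (new? z Q R c i)
    news : Fin d → ℕ
    news c = ∑ (allFin d) (new c)
    pointwise : ∀ c i → misses c R * ind (relevant? (z ∷ Q) R i c)
                      ≤ new c i + misses c R * ind (relevant? Q R i c)
    pointwise c i with R ∋? c | relevant? (z ∷ Q) R i c | relevant? Q R i c
    ... | yes _ | _     | _     = z≤n
    ... | no _  | no _  | _     = z≤n
    ... | no _  | yes _ | yes _ = ≤-refl
    ... | no _  | yes _ | no _  = s≤s z≤n
    column : ∀ c → misses c R * relevants (z ∷ Q) R c ≤ news c + misses c R * relevants Q R c
    column c = begin
      misses c R * relevants (z ∷ Q) R c  ≡⟨ sym (∑-*ˡ (allFin d) (misses c R) _) ⟩
      ∑ (allFin d) (λ i → misses c R * ind (relevant? (z ∷ Q) R i c))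
                                          ≤⟨ ∑-mono (allFin d) (pointwise c) ⟩
      ∑ (allFin d) (λ i → new c i + misses c R * ind (relevant? Q R i c))
                                          ≡⟨ ∑-+ (allFin d) (new c) _ ⟩
      news c + ∑ (allFin d) (λ i → misses c R * ind (relevant? Q R i c))
                                          ≡⟨ cong (_+_ (news c)) (∑-*ˡ (allFin d) (misses c R) _) ⟩
      news c + misses c R * relevants Q R c ∎
    one : ∑ (allFin d) news ≤ 1
    one = ∑-≤1 (allFin⁺ d) news
      (λ c → ∑-≤1 (allFin⁺ d) (new c) (λ i → ind≤1 (new? z Q R c i))
        (λ i j p q → trans (sym (new-part (ind-pos (new? z Q R c i) p))) (new-part (ind-pos (new? z Q R c j) q))))
      (λ c c′ p q →
        let i , _ , p′ = ∑-pos (allFin d) (new c) p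
            j , _ , q′ = ∑-pos (allFin d) (new c′) q
        in new-unique (ind-pos (new? z Q R c i) p′) (ind-pos (new? z Q R c′ j) q′))

  -- 4^k times the bound min(1, n_c(R)² / 4^k) on the probability of a collision at c.
  capped : List X → ℕ → Fin d → List (Fin d) → ℕ
  capped Q k c R = (4 ^ k) ⊓ (relevants Q R c * relevants Q R c)

  capped-mono : ∀ Q k c → MonotoneAwayFrom c (capped Q k c)
  capped-mono Q k c {R} {R′} h = ⊓-monoʳ-≤ (4 ^ k) (*-mono-≤ le le)
    where
    le : relevants Q R c ≤ relevants Q R′ c
    le = ∑-mono (allFin d) (λ i → ind-mono (relevant? Q R i c) (relevant? Q R′ i c) (relevant-mono h))

  Collision : List X → List (Fin d) → (Fin d → Fin d) → Set
  Collision Q R r = ∃ λ i → ∃ λ j → i ≢ j × r i ≡ r j × Relevant Q R i (r i) × Relevant Q R j (r j)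

  -- With the common value c fixed in advance, relevance no longer involves r, so the number of
  -- relevant cells stays constant while r is averaged.
  CollisionAt : List X → List (Fin d) → Fin d → (Fin d → Fin d) → Set
  CollisionAt Q R c r = ∃ λ i → ∃ λ j → i ≢ j × r i ≡ c × r j ≡ c × Relevant Q R i c × Relevant Q R j c

  collision? : ∀ Q R r → Dec (Collision Q R r)
  collision? Q R r = FinP.any? λ i → FinP.any? λ j → ¬? (i FinP.≟ j) ×-dec ((r i FinP.≟ r j)
    ×-dec (relevant? Q R i (r i) ×-dec relevant? Q R j (r j)))

  collisionAt? : ∀ Q R c r → Dec (CollisionAt Q R c r)
  collisionAt? Q R c r = FinP.any? λ i → FinP.any? λ j → ¬? (i FinP.≟ j) ×-dec ((r i FinP.≟ c)
    ×-dec ((r j FinP.≟ c) ×-dec (relevant? Q R i c ×-dec relevant? Q R j c)))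

  collision-localise : ∀ Q R r → (∀ i → r i ∈ R) →
    ind (collision? Q R r) ≤ ∑ (allFin d) (λ c → has c R * ind (collisionAt? Q R c r))
  collision-localise Q R r r∈R with collision? Q R r
  ... | no _ = z≤n
  ... | yes (i , j , i≢j , ri≡rj , rel , rel′) = begin
    1                                                ≡⟨ sym (cong₂ _*_ (ind-true (R ∋? r i) (r∈R i))
         (ind-true (collisionAt? Q R (r i) r) (i , j , i≢j , refl , sym ri≡rj , rel , subst (Relevant Q R j) (sym ri≡rj) rel′))) ⟩
    has (r i) R * ind (collisionAt? Q R (r i) r)     ≤⟨ ∑-∈ (λ c → has c R * ind (collisionAt? Q R c r)) (∈-allFin (r i)) ⟩
    ∑ (allFin d) (λ c → has c R * ind (collisionAt? Q R c r)) ∎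
    where open ≤-Reasoning

  module _ (Q : List X) {R : List (Fin d)} (uR : Unique R) where
    private
      s = length R
      rs = allFuns d R

    -- The minimum of two estimates: a probability is at most 1, and a union bound over the at most
    -- n_c² ordered pairs of distinct relevant cells, each pair having both values equal to c with
    -- probability at most 1/s².
    ∑-collisionAt : ∀ c → (s * s) * ∑ rs (λ r → ind (collisionAt? Q R c r))
                        ≤ s ^ d * ((s * s) ⊓ (relevants Q R c * relevants Q R c))
    ∑-collisionAt c = ≤-trans (⊓-glb trivial pairwise) (≤-reflexive (sym (*-distribˡ-⊓ (s ^ d) (s * s) _)))
      where
      open ≤-Reasoning
      at : (Fin d → Fin d) → ℕ
      at r = ind (collisionAt? Q R c r)
      trivial : (s * s) * ∑ rs at ≤ s ^ d * (s * s)
      trivial = begin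
        (s * s) * ∑ rs at          ≤⟨ *-monoʳ-≤ (s * s) (∑-mono rs (λ r → ind≤1 (collisionAt? Q R c r))) ⟩
        (s * s) * ∑ rs (λ _ → 1)   ≡⟨ cong ((s * s) *_) (trans (∑-const rs 1) (trans (*-identityʳ _) (length-allFuns d R))) ⟩
        (s * s) * s ^ d            ≡⟨ *-comm (s * s) (s ^ d) ⟩
        s ^ d * (s * s)            ∎
      rel : Fin d → ℕ
      rel i = ind (relevant? Q R i c)
      hit : Fin d → Fin d → (Fin d → Fin d) → ℕ
      hit i j r = ind (¬? (i FinP.≟ j)) * hit₂ uR c i j r
      union : ∀ r → at r ≤ ∑ (allFin d) (λ i → ∑ (allFin d) (λ j → rel i * rel j * hit i j r))
      union r with collisionAt? Q R c r
      ... | no _ = z≤n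
      ... | yes (i , j , i≢j , ri , rj , reli , relj) = begin
        1                           ≡⟨ sym (cong₂ _*_ (cong₂ _*_ (ind-true (relevant? Q R i c) reli) (ind-true (relevant? Q R j c) relj))
                                          (cong₂ _*_ (ind-true (¬? (i FinP.≟ j)) i≢j)
                                            (cong₂ _*_ (ind-true (r i FinP.≟ c) ri) (ind-true (r j FinP.≟ c) rj)))) ⟩
        rel i * rel j * hit i j r   ≤⟨ ∑-∈ (λ j → rel i * rel j * hit i j r) (∈-allFin j) ⟩
        ∑ (allFin d) (λ j → rel i * rel j * hit i j r)
                                    ≤⟨ ∑-∈ (λ i → ∑ (allFin d) (λ j → rel i * rel j * hit i j r)) (∈-allFin i) ⟩
        ∑ (allFin d) (λ i → ∑ (allFin d) (λ j → rel i * rel j * hit i j r)) ∎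
      ∑-hit-≢ : ∀ i j → (s * s) * ∑ rs (hit i j) ≤ s ^ d
      ∑-hit-≢ i j with i FinP.≟ j
      ... | yes _  = ≤-trans (≤-reflexive (trans (cong ((s * s) *_) (∑-zero rs _ (λ _ _ → refl))) (*-zeroʳ (s * s)))) z≤n
      ... | no i≢j = ≤-trans (≤-reflexive (cong ((s * s) *_) (∑-cong rs (λ r → *-identityˡ (hit₂ uR c i j r)))))
                             (∑-hit₂ uR c d i j i≢j)
      cell-pair : ∀ i j → (s * s) * ∑ rs (λ r → rel i * rel j * hit i j r) ≤ s ^ d * rel i * rel j
      cell-pair i j = begin
        (s * s) * ∑ rs (λ r → rel i * rel j * hit i j r)  ≡⟨ cong ((s * s) *_) (∑-*ˡ rs (rel i * rel j) (hit i j)) ⟩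
        (s * s) * (rel i * rel j * ∑ rs (hit i j))        ≡⟨ perm (s * s) (rel i * rel j) (∑ rs (hit i j)) ⟩
        (rel i * rel j) * ((s * s) * ∑ rs (hit i j))      ≤⟨ *-monoʳ-≤ (rel i * rel j) (∑-hit-≢ i j) ⟩
        (rel i * rel j) * s ^ d                           ≡⟨ perm′ (rel i) (rel j) (s ^ d) ⟩
        s ^ d * rel i * rel j                             ∎
        where
        perm : ∀ a b c → a * (b * c) ≡ b * (a * c)
        perm = solve-∀
        perm′ : ∀ a b c → (a * b) * c ≡ c * a * b
        perm′ = solve-∀
      pairwise : (s * s) * ∑ rs at ≤ s ^ d * (relevants Q R c * relevants Q R c)
      pairwise = begin
        (s * s) * ∑ rs at
          ≤⟨ *-monoʳ-≤ (s * s) (∑-mono rs union) ⟩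
        (s * s) * ∑ rs (λ r → ∑ (allFin d) (λ i → ∑ (allFin d) (λ j → rel i * rel j * hit i j r)))
          ≡⟨ cong ((s * s) *_) (trans (∑-swap rs (allFin d) (λ r i → ∑ (allFin d) (λ j → rel i * rel j * hit i j r)))
               (∑-cong (allFin d) (λ i → ∑-swap rs (allFin d) (λ r j → rel i * rel j * hit i j r)))) ⟩
        (s * s) * ∑ (allFin d) (λ i → ∑ (allFin d) (λ j → ∑ rs (λ r → rel i * rel j * hit i j r)))
          ≡⟨ sym (trans (∑-cong (allFin d) (λ i → ∑-*ˡ (allFin d) (s * s) _)) (∑-*ˡ (allFin d) (s * s) _)) ⟩
        ∑ (allFin d) (λ i → ∑ (allFin d) (λ j → (s * s) * ∑ rs (λ r → rel i * rel j * hit i j r)))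
          ≤⟨ ∑-mono (allFin d) (λ i → ∑-mono (allFin d) (cell-pair i)) ⟩
        ∑ (allFin d) (λ i → ∑ (allFin d) (λ j → s ^ d * rel i * rel j))
          ≡⟨ ∑-cong (allFin d) (λ i → trans (∑-*ˡ (allFin d) (s ^ d * rel i) rel) (perm (s ^ d) (rel i) _)) ⟩
        ∑ (allFin d) (λ i → s ^ d * relevants Q R c * rel i)
          ≡⟨ trans (∑-*ˡ (allFin d) (s ^ d * relevants Q R c) rel) (*-assoc (s ^ d) _ _) ⟩
        s ^ d * (relevants Q R c * relevants Q R c) ∎
        where
        perm : ∀ a b c → a * b * c ≡ a * c * b
        perm = solve-∀

  weight : List X → ℕ → List (Fin d) → ℕ
  weight Q k R = ∑ (allFin d) (λ c → has c R * capped Q k c R)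

  -- Union bound over the common value c ∈ R: given R, the collision probability is at most
  -- `weight Q k R` / 4^k.
  ∑-collision : ∀ Q {R} k → Unique R → length R ≡ 2 ^ k →
    4 ^ k * ∑ (allFuns d R) (λ r → ind (collision? Q R r)) ≤ length (allFuns d R) * weight Q k R
  ∑-collision Q {R} k uR len = begin
    4 ^ k * ∑ rs (λ r → ind (collision? Q R r))
      ≡⟨ cong (_* ∑ rs (λ r → ind (collision? Q R r))) 4^k ⟩
    (s * s) * ∑ rs (λ r → ind (collision? Q R r))
      ≤⟨ *-monoʳ-≤ (s * s) (∑-mono-∈ rs (λ r r∈ → collision-localise Q R r (All.lookup (allFuns-∈ d R) r∈))) ⟩
    (s * s) * ∑ rs (λ r → ∑ (allFin d) (λ c → has c R * at c r))
      ≡⟨ cong ((s * s) *_) (trans (∑-swap rs (allFin d) (λ r c → has c R * at c r))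
           (∑-cong (allFin d) (λ c → ∑-*ˡ rs (has c R) (at c)))) ⟩
    (s * s) * ∑ (allFin d) (λ c → has c R * ∑ rs (at c))
      ≡⟨ sym (∑-*ˡ (allFin d) (s * s) _) ⟩
    ∑ (allFin d) (λ c → (s * s) * (has c R * ∑ rs (at c)))
      ≤⟨ ∑-mono (allFin d) term ⟩
    ∑ (allFin d) (λ c → s ^ d * (has c R * capped Q k c R))
      ≡⟨ ∑-*ˡ (allFin d) (s ^ d) _ ⟩
    s ^ d * weight Q k R
      ≡⟨ cong (_* weight Q k R) (sym (length-allFuns d R)) ⟩
    length rs * weight Q k R ∎
    where
    open ≤-Reasoning
    s = length R
    rs = allFuns d R
    at : Fin d → (Fin d → Fin d) → ℕ
    at c r = ind (collisionAt? Q R c r)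
    perm : ∀ a b c → a * (b * c) ≡ b * (a * c)
    perm = solve-∀
    4^k : 4 ^ k ≡ s * s
    4^k = trans (4^≡2^*2^ k) (sym (cong₂ _*_ len len))
    term : ∀ c → (s * s) * (has c R * ∑ rs (at c)) ≤ s ^ d * (has c R * capped Q k c R)
    term c = begin
      (s * s) * (has c R * ∑ rs (at c))       ≡⟨ perm (s * s) (has c R) _ ⟩
      has c R * ((s * s) * ∑ rs (at c))       ≤⟨ *-monoʳ-≤ (has c R) (∑-collisionAt Q uR c) ⟩
      has c R * (s ^ d * ((s * s) ⊓ (relevants Q R c * relevants Q R c)))
                                              ≡⟨ cong (λ z → has c R * (s ^ d * (z ⊓ (relevants Q R c * relevants Q R c)))) (sym 4^k) ⟩
      has c R * (s ^ d * capped Q k c R)      ≡⟨ perm (has c R) (s ^ d) _ ⟩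
      s ^ d * (has c R * capped Q k c R)      ∎

  weightOff : List X → ℕ → List (Fin d) → ℕ
  weightOff Q k R = ∑ (allFin d) (λ c → misses c R * capped Q k c R)

  -- The exchange is made for each c separately and then summed. In averages: the mean of `weight`
  -- over sets of size 2^k is at most 2^k / (d - S) times the mean of `weightOff` over sets of size
  -- S.
  ∑-weight : ∀ Q k S → 2 ^ k ≤ S → S < d →
    ((d ∸ S) * choose d S) * ∑Sub d (2 ^ k) (weight Q k)
    ≤ choose d (2 ^ k) * (2 ^ k * ∑Sub d S (weightOff Q k))
  ∑-weight Q k S s≤S S<d = begin
    D * ∑Sub d s (weight Q k)
      ≡⟨ cong (D *_) (∑-swap (subsetsOfSize d s) (allFin d) (λ R c → has c R * capped Q k c R)) ⟩
    D * ∑ (allFin d) (λ c → ∑Sub d s (λ R → has c R * capped Q k c R))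
      ≡⟨ sym (∑-*ˡ (allFin d) D _) ⟩
    ∑ (allFin d) (λ c → D * ∑Sub d s (λ R → has c R * capped Q k c R))
      ≤⟨ ∑-mono (allFin d) (λ c → ∑Sub-exchange d s S c (capped-mono Q k c) (m^n>0 2 k) s≤S S<d) ⟩
    ∑ (allFin d) (λ c → (s * choose d s) * ∑Sub d S (λ R → misses c R * capped Q k c R))
      ≡⟨ ∑-*ˡ (allFin d) (s * choose d s) _ ⟩
    (s * choose d s) * ∑ (allFin d) (λ c → ∑Sub d S (λ R → misses c R * capped Q k c R))
      ≡⟨ cong ((s * choose d s) *_) (sym (∑-swap (subsetsOfSize d S) (allFin d) (λ R c → misses c R * capped Q k c R))) ⟩
    (s * choose d s) * ∑Sub d S (weightOff Q k)
      ≡⟨ trans (cong (_* ∑Sub d S (weightOff Q k)) (*-comm s (choose d s))) (*-assoc (choose d s) s _) ⟩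
    choose d s * (s * ∑Sub d S (weightOff Q k)) ∎
    where
    open ≤-Reasoning
    s = 2 ^ k
    D = (d ∸ S) * choose d S

  -- As every level uses the same family of sets, the sum over k moves innermost. There R and c are
  -- fixed, `geometric-bound` gives a multiple of n_c(R), and `∑-relevants` sums this over c.
  ∑-levels-weightOff : ∀ Q K S →
    ∑ (levels K) (λ k → 2 ^ (K ∸ k) * ∑Sub d S (weightOff Q k)) ≤ choose d S * (4 * 2 ^ K * length Q)
  ∑-levels-weightOff Q K S = begin
    ∑ (levels K) (λ k → 2 ^ (K ∸ k) * ∑Sub d S (weightOff Q k))
      ≡⟨ ∑-cong (levels K) (λ k → sym (trans
           (∑-cong Ss (λ R → ∑-*ˡ (allFin d) (2 ^ (K ∸ k)) (λ c → misses c R * capped Q k c R)))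
           (∑-*ˡ Ss (2 ^ (K ∸ k)) (weightOff Q k)))) ⟩
    ∑ (levels K) (λ k → ∑ Ss (λ R → ∑ (allFin d) (λ c → 2 ^ (K ∸ k) * (misses c R * capped Q k c R))))
      ≡⟨ trans (∑-swap (levels K) Ss _) (∑-cong Ss (λ R → ∑-swap (levels K) (allFin d)
           (λ k c → 2 ^ (K ∸ k) * (misses c R * capped Q k c R)))) ⟩
    ∑ Ss (λ R → ∑ (allFin d) (λ c → ∑ (levels K) (λ k → 2 ^ (K ∸ k) * (misses c R * capped Q k c R))))
      ≤⟨ ∑-mono Ss (λ R → ∑-mono (allFin d) (column R)) ⟩
    ∑ Ss (λ R → ∑ (allFin d) (λ c → 4 * 2 ^ K * (misses c R * relevants Q R c)))
      ≡⟨ ∑-cong Ss (λ R → ∑-*ˡ (allFin d) (4 * 2 ^ K) _) ⟩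
    ∑ Ss (λ R → 4 * 2 ^ K * ∑ (allFin d) (λ c → misses c R * relevants Q R c))
      ≤⟨ ∑-mono Ss (λ R → *-monoʳ-≤ (4 * 2 ^ K) (∑-relevants Q R)) ⟩
    ∑ Ss (λ R → 4 * 2 ^ K * length Q)
      ≡⟨ ∑-const Ss _ ⟩
    choose d S * (4 * 2 ^ K * length Q) ∎
    where
    open ≤-Reasoning
    Ss = subsetsOfSize d S
    perm : ∀ a b c → a * (b * c) ≡ b * (a * c)
    perm = solve-∀
    perm′ : ∀ a n u → a * (4 * (n * u)) ≡ 4 * u * (a * n)
    perm′ = solve-∀
    column : ∀ R c → ∑ (levels K) (λ k → 2 ^ (K ∸ k) * (misses c R * capped Q k c R))
                   ≤ 4 * 2 ^ K * (misses c R * relevants Q R c)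
    column R c = begin
      ∑ (levels K) (λ k → 2 ^ (K ∸ k) * (misses c R * capped Q k c R))
        ≡⟨ trans (∑-cong (levels K) (λ k → perm (2 ^ (K ∸ k)) (misses c R) (capped Q k c R)))
                 (∑-*ˡ (levels K) (misses c R) _) ⟩
      misses c R * ∑ (levels K) (λ k → 2 ^ (K ∸ k) * capped Q k c R)
        ≡⟨ cong (misses c R *_) (∑-levels-geometric (relevants Q R c) K) ⟩
      misses c R * geometric (relevants Q R c) K
        ≤⟨ *-monoʳ-≤ (misses c R) (geometric-bound (relevants Q R c) K) ⟩
      misses c R * (4 * (relevants Q R c * 2 ^ K))
        ≡⟨ perm′ (misses c R) (relevants Q R c) (2 ^ K) ⟩
      4 * 2 ^ K * (misses c R * relevants Q R c) ∎

-- Expansions in base 3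

horner : ∀ n → (Fin n → ℤ) → ℤ
horner zero    D = + 0
horner (suc n) D = D Fin.zero ℤ.+ + 3 ℤ.* horner n (D ∘ Fin.suc)

horner-cong : ∀ n {D D′ : Fin n → ℤ} → (∀ b → D b ≡ D′ b) → horner n D ≡ horner n D′
horner-cong zero    h = refl
horner-cong (suc n) h = cong₂ (λ a z → a ℤ.+ + 3 ℤ.* z) (h Fin.zero) (horner-cong n (h ∘ Fin.suc))

horner-+ : ∀ n (D E : Fin n → ℤ) → horner n (λ b → D b ℤ.+ E b) ≡ horner n D ℤ.+ horner n E
horner-+ zero    D E = refl
horner-+ (suc n) D E rewrite horner-+ n (D ∘ Fin.suc) (E ∘ Fin.suc) =
  shuffle (D Fin.zero) (E Fin.zero) (horner n (D ∘ Fin.suc)) (horner n (E ∘ Fin.suc))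
  where
  shuffle : ∀ a b c d → (a ℤ.+ b) ℤ.+ + 3 ℤ.* (c ℤ.+ d) ≡ (a ℤ.+ + 3 ℤ.* c) ℤ.+ (b ℤ.+ + 3 ℤ.* d)
  shuffle = ℤSolver.solve-∀

horner-- : ∀ n (D E : Fin n → ℤ) → horner n (λ b → D b ℤ.- E b) ≡ horner n D ℤ.- horner n E
horner-- zero    D E = refl
horner-- (suc n) D E rewrite horner-- n (D ∘ Fin.suc) (E ∘ Fin.suc) =
  shuffle (D Fin.zero) (E Fin.zero) (horner n (D ∘ Fin.suc)) (horner n (E ∘ Fin.suc))
  where
  shuffle : ∀ a b c d → (a ℤ.- b) ℤ.+ + 3 ℤ.* (c ℤ.- d) ≡ (a ℤ.+ + 3 ℤ.* c) ℤ.- (b ℤ.+ + 3 ℤ.* d)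
  shuffle = ℤSolver.solve-∀

horner-0 : ∀ n → horner n (λ _ → + 0) ≡ + 0
horner-0 zero    = refl
horner-0 (suc n) rewrite horner-0 n = refl

==-suc : (b c : Fin n) → (Fin.suc b ==ᶠ Fin.suc c) ≡ (b ==ᶠ c)
==-suc b c with b FinP.≟ c
... | yes _ = refl
... | no _  = refl

==-≢ : {b c : Fin n} → b ≢ c → (b ==ᶠ c) ≡ false
==-≢ {b = b} {c} b≢c with b FinP.≟ c
... | yes e = contradiction e b≢c
... | no _  = refl

horner-single : ∀ n (c : Fin n) (f : Fin n → ℤ) →
  horner n (λ b → if b ==ᶠ c then f b else + 0) ≡ f c ℤ.* + (3 ^ toℕ c)
horner-single (suc n) Fin.zero f =
  trans (cong (λ z → f Fin.zero ℤ.+ + 3 ℤ.* z) (horner-0 n))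
        (trans (ℤP.+-identityʳ (f Fin.zero)) (sym (ℤP.*-identityʳ (f Fin.zero))))
horner-single (suc n) (Fin.suc c) f = begin
  + 0 ℤ.+ + 3 ℤ.* horner n (λ b → if Fin.suc b ==ᶠ Fin.suc c then f (Fin.suc b) else + 0)
    ≡⟨ cong (λ z → + 0 ℤ.+ + 3 ℤ.* z) (horner-cong n (λ b →
         cong (λ q → if q then f (Fin.suc b) else + 0) (==-suc b c))) ⟩
  + 0 ℤ.+ + 3 ℤ.* horner n (λ b → if b ==ᶠ c then f (Fin.suc b) else + 0)
    ≡⟨ cong (λ z → + 0 ℤ.+ + 3 ℤ.* z) (horner-single n c (f ∘ Fin.suc)) ⟩
  + 0 ℤ.+ + 3 ℤ.* (f (Fin.suc c) ℤ.* + (3 ^ toℕ c))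
    ≡⟨ perm (f (Fin.suc c)) (+ (3 ^ toℕ c)) ⟩
  f (Fin.suc c) ℤ.* (+ 3 ℤ.* + (3 ^ toℕ c))
    ≡⟨ cong (f (Fin.suc c) ℤ.*_) (sym (ℤP.pos-* 3 (3 ^ toℕ c))) ⟩
  f (Fin.suc c) ℤ.* + (3 ^ suc (toℕ c)) ∎
  where
  open ≡-Reasoning
  perm : ∀ a b → + 0 ℤ.+ + 3 ℤ.* (a ℤ.* b) ≡ a ℤ.* (+ 3 ℤ.* b)
  perm = ℤSolver.solve-∀

sumℤ-*ˡ : ∀ {A : Set} (xs : List A) c (f : A → ℤ) → sumℤ (map (λ x → c ℤ.* f x) xs) ≡ c ℤ.* sumℤ (map f xs)
sumℤ-*ˡ []       c f = sym (ℤP.*-zeroʳ c)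
sumℤ-*ˡ (x ∷ xs) c f rewrite sumℤ-*ˡ xs c f = sym (ℤP.*-distribˡ-+ c (f x) _)

sumℤ-allFin-suc : ∀ n (f : Fin (suc n) → ℤ) →
  sumℤ (map f (allFin (suc n))) ≡ f Fin.zero ℤ.+ sumℤ (map (f ∘ Fin.suc) (allFin n))
sumℤ-allFin-suc n f = cong (λ xs → f Fin.zero ℤ.+ sumℤ xs)
  (trans (map-tabulate Fin.suc f) (sym (map-tabulate id (f ∘ Fin.suc))))

sumℤ-horner : ∀ n (D : Fin n → ℤ) → sumℤ (map (λ b → D b ℤ.* + (3 ^ toℕ b)) (allFin n)) ≡ horner n D
sumℤ-horner zero    D = refl
sumℤ-horner (suc n) D = trans (sumℤ-allFin-suc n (λ b → D b ℤ.* + (3 ^ toℕ b)))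
  (cong₂ ℤ._+_ (ℤP.*-identityʳ (D Fin.zero)) (begin
    sumℤ (map (λ b → D (Fin.suc b) ℤ.* + (3 ^ suc (toℕ b))) (allFin n))
      ≡⟨ cong sumℤ (map-cong (λ b → trans (cong (D (Fin.suc b) ℤ.*_) (ℤP.pos-* 3 (3 ^ toℕ b)))
            (perm (D (Fin.suc b)) (+ (3 ^ toℕ b)))) (allFin n)) ⟩
    sumℤ (map (λ b → + 3 ℤ.* (D (Fin.suc b) ℤ.* + (3 ^ toℕ b))) (allFin n))
      ≡⟨ sumℤ-*ˡ (allFin n) (+ 3) _ ⟩
    + 3 ℤ.* sumℤ (map (λ b → D (Fin.suc b) ℤ.* + (3 ^ toℕ b)) (allFin n))
      ≡⟨ cong (+ 3 ℤ.*_) (sumℤ-horner n (D ∘ Fin.suc)) ⟩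
    + 3 ℤ.* horner n (D ∘ Fin.suc) ∎))
  where
  open ≡-Reasoning
  perm : ∀ a b → a ℤ.* (+ 3 ℤ.* b) ≡ + 3 ℤ.* (a ℤ.* b)
  perm = ℤSolver.solve-∀

SameSign : ℤ → ℤ → Set
SameSign a b = (+ 0 ℤ.< a × + 0 ℤ.< b) ⊎ (a ℤ.< + 0 × b ℤ.< + 0)

-- The range of a difference of two digits. With |a| ≤ 2, the number a + 3h has the sign of h for
-- every nonzero integer h.
IsDigit : ℤ → Set
IsDigit a = -[1+ 1 ] ℤ.≤ a × a ℤ.≤ + 2

isDigit? : ∀ a → Dec (IsDigit a)
isDigit? a = (-[1+ 1 ] ℤ.≤? a) ×-dec (a ℤ.≤? + 2)

horner-step-pos : ∀ {a h} → IsDigit a → + 0 ℤ.< h → + 0 ℤ.< a ℤ.+ + 3 ℤ.* h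
horner-step-pos {a} {h} (lo , _) pos =
  ℤP.<-≤-trans (+<+ (s≤s z≤n)) (ℤP.+-mono-≤ lo (ℤP.*-monoˡ-≤-nonNeg (+ 3) (ℤP.i<j⇒suc[i]≤j pos)))

horner-step-neg : ∀ {a h} → IsDigit a → h ℤ.< + 0 → a ℤ.+ + 3 ℤ.* h ℤ.< + 0
horner-step-neg {a} {h} (_ , hi) neg =
  ℤP.≤-<-trans (ℤP.+-mono-≤ hi (ℤP.*-monoˡ-≤-nonNeg (+ 3) (ℤP.i<j⇒i≤pred[j] neg))) ℤ.-<+

horner-step : ∀ {a a′ h h′} → IsDigit a → IsDigit a′ → SameSign h h′ →
              SameSign (a ℤ.+ + 3 ℤ.* h) (a′ ℤ.+ + 3 ℤ.* h′)
horner-step da da′ (inj₁ (p , p′)) = inj₁ (horner-step-pos da p , horner-step-pos da′ p′)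
horner-step da da′ (inj₂ (p , p′)) = inj₂ (horner-step-neg da p , horner-step-neg da′ p′)

-- 2 · (1 + 3 + … + 3^(t−1)) < 3^t, so the digits below a nonzero one do not influence the sign.
horner-sign : ∀ n (D D′ : Fin n → ℤ) → (∀ b → IsDigit (D b)) → (∀ b → IsDigit (D′ b)) →
  ∀ t → D t ≢ + 0 → (∀ b → toℕ t ℕ.≤ toℕ b → D b ≡ D′ b) → SameSign (horner n D) (horner n D′)
horner-sign (suc n) D D′ dD dD′ (Fin.suc t) ne same =
  horner-step (dD Fin.zero) (dD′ Fin.zero)
    (horner-sign n (D ∘ Fin.suc) (D′ ∘ Fin.suc) (dD ∘ Fin.suc) (dD′ ∘ Fin.suc) t ne
      (λ b le → same (Fin.suc b) (s≤s le)))
horner-sign (suc n) D D′ dD dD′ Fin.zero ne same =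
  subst (SameSign (horner (suc n) D)) (horner-cong (suc n) {D} {D′} (λ b → same b z≤n)) nonzero
  where
  h = horner n (D ∘ Fin.suc)
  nonzero : SameSign (horner (suc n) D) (horner (suc n) D)
  nonzero with ℤP.<-cmp h (+ 0)
  ... | tri< lt _ _ = horner-step (dD Fin.zero) (dD Fin.zero) (inj₂ (lt , lt))
  ... | tri> _ _ gt = horner-step (dD Fin.zero) (dD Fin.zero) (inj₁ (gt , gt))
  ... | tri≈ _ e _  rewrite e | ℤP.+-identityʳ (D Fin.zero) with ℤP.<-cmp (D Fin.zero) (+ 0)
  ...   | tri< lt _ _ = inj₂ (lt , lt)
  ...   | tri≈ _ z _  = contradiction z ne
  ...   | tri> _ _ gt = inj₁ (gt , gt)

-- Labels of pairs as signs of base 3 numbers.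

SameOrder : ℤ → ℤ → ℤ → ℤ → Set
SameOrder a b a′ b′ = (a ℤ.< b × a′ ℤ.< b′) ⊎ (a ≡ b × a′ ≡ b′) ⊎ (b ℤ.< a × b′ ℤ.< a′)

sgnZ-< : ∀ {a b} → a ℤ.< b → sgnZ a b ≡ + 1
sgnZ-< {a} {b} lt with a ℤ.<? b | a ℤ.≟ b
... | yes _ | _ = refl
... | no ge | _ = contradiction lt ge

sgnZ-≡ : ∀ {a b} → a ≡ b → sgnZ a b ≡ + 0
sgnZ-≡ {a} {b} e with a ℤ.<? b | a ℤ.≟ b
... | yes lt | _     = contradiction e (ℤP.<⇒≢ lt)
... | no _   | yes _ = refl
... | no _   | no ne = contradiction e ne

sgnZ-> : ∀ {a b} → b ℤ.< a → sgnZ a b ≡ -[1+ 0 ]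
sgnZ-> {a} {b} gt with a ℤ.<? b | a ℤ.≟ b
... | yes lt | _     = contradiction gt (ℤP.<-asym lt)
... | no _   | yes e = contradiction (sym e) (ℤP.<⇒≢ gt)
... | no _   | no _  = refl

sgnZ-sameOrder : ∀ {a b a′ b′} → SameOrder a b a′ b′ → sgnZ a b ≡ sgnZ a′ b′
sgnZ-sameOrder (inj₁ (p , p′))        = trans (sgnZ-< p) (sym (sgnZ-< p′))
sgnZ-sameOrder (inj₂ (inj₁ (p , p′))) = trans (sgnZ-≡ p) (sym (sgnZ-≡ p′))
sgnZ-sameOrder (inj₂ (inj₂ (p , p′))) = trans (sgnZ-> p) (sym (sgnZ-> p′))

sameOrder-swap : ∀ {a b a′ b′} → SameOrder a b a′ b′ → SameOrder b a b′ a′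
sameOrder-swap (inj₁ p)               = inj₂ (inj₂ p)
sameOrder-swap (inj₂ (inj₁ (p , p′))) = inj₂ (inj₁ (sym p , sym p′))
sameOrder-swap (inj₂ (inj₂ p))        = inj₁ p

sgnPair-sameOrder : ∀ (h h′ : Vec Bool n → ℤ) x y →
                    SameOrder (h x) (h y) (h′ x) (h′ y) → sgnPair h x y ≡ sgnPair h′ x y
sgnPair-sameOrder h h′ x y o with val x ℕ.<ᵇ val y
... | true  = sgnZ-sameOrder o
... | false = sgnZ-sameOrder (sameOrder-swap o)

-- `horner` is linear, so an order depends only on the differences of the digits. The alternative of
-- equal differences is what covers equal values, since `SameSign` excludes zero.
horner-sameOrder : ∀ n (X Y X′ Y′ : Fin n → ℤ) →
  (∀ b → Y b ℤ.- X b ≡ Y′ b ℤ.- X′ b) ⊎ SameSign (horner n (λ b → Y b ℤ.- X b)) (horner n (λ b → Y′ b ℤ.- X′ b)) →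
  SameOrder (horner n X) (horner n Y) (horner n X′) (horner n Y′)
horner-sameOrder n X Y X′ Y′ hyp = classify sign
  where
  diff : (X Y : Fin n → ℤ) → ℤ
  diff X Y = horner n (λ b → Y b ℤ.- X b)
  Sign : ℤ → ℤ → Set
  Sign a b = SameSign a b ⊎ (a ≡ + 0 × b ≡ + 0)
  sign : Sign (diff X Y) (diff X′ Y′)
  sign = case hyp of λ where
    (inj₂ s) → inj₁ s
    (inj₁ e) → subst (Sign (diff X Y)) (horner-cong n e) (case ℤP.<-cmp (diff X Y) (+ 0) of λ where
      (tri< lt _ _) → inj₁ (inj₂ (lt , lt))
      (tri≈ _ z _)  → inj₂ (z , z)
      (tri> _ _ gt) → inj₁ (inj₁ (gt , gt)))
  cancel : ∀ a b → (a ℤ.- b) ℤ.+ b ≡ a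
  cancel = ℤSolver.solve-∀
  recover : ∀ X Y → diff X Y ℤ.+ horner n X ≡ horner n Y
  recover X Y = trans (cong (ℤ._+ horner n X) (horner-- n Y X)) (cancel (horner n Y) (horner n X))
  pos : ∀ X Y → + 0 ℤ.< diff X Y → horner n X ℤ.< horner n Y
  pos X Y p = subst₂ ℤ._<_ (ℤP.+-identityˡ _) (recover X Y) (ℤP.+-monoˡ-< (horner n X) p)
  neg : ∀ X Y → diff X Y ℤ.< + 0 → horner n Y ℤ.< horner n X
  neg X Y p = subst₂ ℤ._<_ (recover X Y) (ℤP.+-identityˡ _) (ℤP.+-monoˡ-< (horner n X) p)
  nul : ∀ X Y → diff X Y ≡ + 0 → horner n X ≡ horner n Y
  nul X Y p = sym (ℤP.i-j≡0⇒i≡j _ _ (trans (sym (horner-- n Y X)) p))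
  classify : Sign (diff X Y) (diff X′ Y′) → SameOrder (horner n X) (horner n Y) (horner n X′) (horner n Y′)
  classify (inj₁ (inj₁ (p , p′))) = inj₁ (pos X Y p , pos X′ Y′ p′)
  classify (inj₁ (inj₂ (p , p′))) = inj₂ (inj₂ (neg X Y p , neg X′ Y′ p′))
  classify (inj₂ (p , p′))        = inj₂ (inj₁ (nul X Y p , nul X′ Y′ p′))

-- Merges the two contributions at one position: the plain sum, absent where the position is masked
-- by R, and the signed term, present where the position is r_i.
digit : (masked active sign bit : Bool) → ℤ
digit p q s v = (if p then + 0 else + (bit v)) ℤ.+ (if q then sgnB s ℤ.* + (bit v) else + 0)

all-Bool? : {P : Bool → Set} → (∀ b → Dec (P b)) → Dec (∀ b → P b)
all-Bool? P? = map′ (λ { (t , f) true → t ; (t , f) false → f }) (λ h → h true , h false) (P? true ×-dec P? false)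

digit-difference : ∀ p q q′ s s′ v v′ → IsDigit (digit p q s v ℤ.- digit p q′ s′ v′)
digit-difference = from-yes (all-Bool? λ p → all-Bool? λ q → all-Bool? λ q′ → all-Bool? λ s →
  all-Bool? λ s′ → all-Bool? λ v → all-Bool? λ v′ →
  isDigit? (digit p q s v ℤ.- digit p q′ s′ v′))

digit-≢ : ∀ s s′ v v′ → v ≢ v′ → digit false false s v′ ℤ.- digit false false s′ v ≢ + 0
digit-≢ s s′ true  true  ne _ = ne refl
digit-≢ s s′ false false ne _ = ne refl
digit-≢ s s′ true  false ne ()
digit-≢ s s′ false true  ne ()

anyᵇ-false : ∀ {A : Set} (p : A → Bool) (xs : List A) → (∀ x → x ∈ xs → p x ≡ false) → anyᵇ p xs ≡ false
anyᵇ-false p []       h = refl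
anyᵇ-false p (x ∷ xs) h rewrite h x (here refl) = anyᵇ-false p xs (λ y y∈ → h y (there y∈))

bitsToFin-cong : ∀ m {f g : Fin m → Bool} → (∀ j → f j ≡ g j) → bitsToFin m f ≡ bitsToFin m g
bitsToFin-cong zero    h = refl
bitsToFin-cong (suc m) h rewrite h Fin.zero | bitsToFin-cong m (h ∘ Fin.suc) = refl

pairs-∈ : ∀ {A : Set} (Q : List A) → All (λ p → proj₁ p ∈ Q × proj₂ p ∈ Q) (pairs Q)
pairs-∈ []      = []
pairs-∈ (x ∷ Q) = AllP.++⁺
  (AllP.map⁺ (All.tabulate (λ y∈ → here refl , there y∈)))
  (All.map (λ (p , q) → there p , there q) (pairs-∈ Q))

lowBit : ∀ m → Point m → Fin (dim m) → Bool
lowBit m x c = lookup x (low m c)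

module _ (m : ℕ) (R : List (Fin (dim m))) (r : Fin (dim m) → Fin (dim m)) where
  open Relevance (cell m) (lowBit m)

  private
    N = dim' m
    Cell = Fin (dim m)

  masked : Fin N → Bool
  masked b = anyᵇ (λ c → low m c ==ᶠ b) R

  active : Cell → Fin N → Bool
  active i b = b ==ᶠ low m (r i)

  digits : (Cell → Bool) → Point m → Fin N → ℤ
  digits s x b = digit (masked b) (active (cell m x) b) (s (cell m x)) (lookup x b)

  -- Coordinates are 1-based in the exponents and 0-based in `horner`; the resulting common factor 3
  -- is positive and preserves order.
  hFun-horner : ∀ s x → hFun m R r s x ≡ + 3 ℤ.* horner N (digits s x)
  hFun-horner s x = begin
    hFun m R r s x
      ≡⟨ cong₂ ℤ._+_ (trans (cong sumℤ (map-cong scale (allFin N)))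
            (trans (sumℤ-*ˡ (allFin N) (+ 3) _) (cong (+ 3 ℤ.*_) (sumℤ-horner N plain))))
          (trans special (cong (+ 3 ℤ.*_) (sym (horner-single N (low m (r i)) (λ b → sgnB (s i) ℤ.* + (bit (lookup x b))))))) ⟩
    + 3 ℤ.* horner N plain ℤ.+ + 3 ℤ.* horner N extra
      ≡⟨ sym (ℤP.*-distribˡ-+ (+ 3) (horner N plain) (horner N extra)) ⟩
    + 3 ℤ.* (horner N plain ℤ.+ horner N extra)
      ≡⟨ cong (+ 3 ℤ.*_) (sym (horner-+ N plain extra)) ⟩
    + 3 ℤ.* horner N (digits s x) ∎
    where
    open ≡-Reasoning
    i = cell m x
    plain extra : Fin N → ℤ
    plain b = if masked b then + 0 else + (bit (lookup x b))
    extra b = if active i b then sgnB (s i) ℤ.* + (bit (lookup x b)) else + 0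
    pos-scale : ∀ v k → + (v ℕ.* 3 ^ suc k) ≡ + 3 ℤ.* (+ v ℤ.* + (3 ^ k))
    pos-scale v k = trans (ℤP.pos-* v (3 ^ suc k)) (trans (cong (+ v ℤ.*_) (ℤP.pos-* 3 (3 ^ k))) (perm (+ v) (+ (3 ^ k))))
      where
      perm : ∀ a b → a ℤ.* (+ 3 ℤ.* b) ≡ + 3 ℤ.* (a ℤ.* b)
      perm = ℤSolver.solve-∀
    scale : ∀ b → (if masked b then + 0 else + (bit (lookup x b) ℕ.* 3 ^ suc (toℕ b)))
                ≡ + 3 ℤ.* (plain b ℤ.* + (3 ^ toℕ b))
    scale b with masked b
    ... | true  = refl
    ... | false = pos-scale (bit (lookup x b)) (toℕ b)
    special : sgnB (s i) ℤ.* + (bit (lookup x (low m (r i))) ℕ.* 3 ^ suc (toℕ (r i)))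
            ≡ + 3 ℤ.* ((sgnB (s i) ℤ.* + (bit (lookup x (low m (r i))))) ℤ.* + (3 ^ toℕ (low m (r i))))
    special = trans (cong (sgnB (s i) ℤ.*_) (pos-scale (bit (lookup x (low m (r i)))) (toℕ (r i))))
      (trans (perm (sgnB (s i)) (+ (bit (lookup x (low m (r i))))) (+ (3 ^ toℕ (r i))))
             (cong (λ k → + 3 ℤ.* ((sgnB (s i) ℤ.* + (bit (lookup x (low m (r i))))) ℤ.* + (3 ^ k)))
                   (sym (FinP.toℕ-↑ˡ (r i) m))))
      where
      perm : ∀ a b c → a ℤ.* (+ 3 ℤ.* (b ℤ.* c)) ≡ + 3 ℤ.* ((a ℤ.* b) ℤ.* c)
      perm = ℤSolver.solve-∀

  inactive : ∀ i {b : Fin N} → toℕ (r i) ℕ.< toℕ b → active i b ≡ false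
  inactive i lt = ==-≢ λ e → <-irrefl (trans (sym (FinP.toℕ-↑ˡ (r i) m)) (cong toℕ (sym e))) lt

  unmasked : ∀ {b : Fin N} → (∀ c → c ∈ R → low m c ≢ b) → masked b ≡ false
  unmasked h = anyᵇ-false _ R (λ c c∈ → ==-≢ (h c c∈))

  Decided : (s s′ : Cell → Bool) → Point m → Point m → Set
  Decided s s′ x y =
    (∀ b → digits s y b ℤ.- digits s x b ≡ digits s′ y b ℤ.- digits s′ x b)
    ⊎ SameSign (horner N (λ b → digits s y b ℤ.- digits s x b)) (horner N (λ b → digits s′ y b ℤ.- digits s′ x b))

  -- No digit from t upwards is active, so the differences there do not involve the signs. The
  -- difference at t is nonzero, hence `horner-sign` makes everything below t, including both signed
  -- terms, irrelevant.
  decided-above : ∀ s s′ {x y} t → masked t ≡ false → lookup x t ≢ lookup y t →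
    toℕ (r (cell m x)) ℕ.< toℕ t → toℕ (r (cell m y)) ℕ.< toℕ t → Decided s s′ x y
  decided-above s s′ {x} {y} t um ne ltx lty = inj₂ (horner-sign N _ _ (isDigit s) (isDigit s′) t nonzero same)
    where
    isDigit : ∀ s b → IsDigit (digits s y b ℤ.- digits s x b)
    isDigit s b = digit-difference (masked b) (active (cell m y) b) (active (cell m x) b)
                    (s (cell m y)) (s (cell m x)) (lookup y b) (lookup x b)
    nonzero : digits s y t ℤ.- digits s x t ≢ + 0
    nonzero rewrite um | inactive (cell m x) {t} ltx | inactive (cell m y) {t} lty =
      digit-≢ (s (cell m y)) (s (cell m x)) (lookup x t) (lookup y t) ne
    same : ∀ b → toℕ t ℕ.≤ toℕ b → digits s y b ℤ.- digits s x b ≡ digits s′ y b ℤ.- digits s′ x b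
    same b t≤b rewrite inactive (cell m x) {b} (<-≤-trans ltx t≤b)
                     | inactive (cell m y) {b} (<-≤-trans lty t≤b) = refl

  high>low : (c : Cell) (j : Fin m) → toℕ c ℕ.< toℕ (dim m ↑ʳ j)
  high>low c j = <-≤-trans (FinP.toℕ<n c)
    (≤-trans (m≤m+n (dim m) (toℕ j)) (≤-reflexive (sym (FinP.toℕ-↑ʳ (dim m) j))))

  -- Points of different cells differ in one of the top m coordinates, which lie above every r_i and
  -- are never masked by R.
  decided-cross : ∀ s s′ {x y} → cell m x ≢ cell m y → Decided s s′ x y
  decided-cross s s′ {x} {y} ne with FinP.any? (λ j → ¬? (lookup x (dim m ↑ʳ j) BoolP.≟ lookup y (dim m ↑ʳ j)))
  ... | yes (j , d) = decided-above s s′ {x} {y} (dim m ↑ʳ j)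
    (unmasked λ c _ e → <-irrefl (trans (sym (FinP.toℕ-↑ˡ c m)) (cong toℕ e)) (high>low c j))
    d (high>low _ j) (high>low _ j)
  ... | no agree = contradiction (bitsToFin-cong m (λ j →
    case lookup x (dim m ↑ʳ j) BoolP.≟ lookup y (dim m ↑ʳ j) of λ where
      (yes e) → e
      (no d)  → contradiction (j , d) agree)) ne

  -- Three cases. If x and y agree at r_i, their signed terms cancel. If they differ there and agree
  -- above it off R, the cell is relevant and the two signs coincide by hypothesis. Otherwise an
  -- unmasked coordinate above r_i decides the label.
  decided-within : ∀ s s′ {Q x y} → x ∈ Q → y ∈ Q → cell m x ≡ cell m y →
    (Relevant Q R (cell m x) (r (cell m x)) → s (cell m x) ≡ s′ (cell m x)) → Decided s s′ x y
  decided-within s s′ {Q} {x} {y} x∈ y∈ xy dep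
    with lowBit m x (r (cell m x)) BoolP.≟ lowBit m y (r (cell m x))
  ... | yes e = inj₁ same
    where
    i = cell m x
    cancel : ∀ p q s s′ v → digit p q s v ℤ.- digit p q s v ≡ digit p q s′ v ℤ.- digit p q s′ v
    cancel p q s s′ v = trans (ℤP.+-inverseʳ (digit p q s v)) (sym (ℤP.+-inverseʳ (digit p q s′ v)))
    same : ∀ b → digits s y b ℤ.- digits s x b ≡ digits s′ y b ℤ.- digits s′ x b
    same b rewrite sym xy with b FinP.≟ low m (r i)
    ... | yes refl rewrite e = cancel (masked (low m (r i))) true (s i) (s′ i) (lookup y (low m (r i)))
    ... | no _ = refl
  ... | no ne with agree? R (r (cell m x)) x y
  ...   | yes agree = inj₁ λ b → same b
    where
    equal : s (cell m x) ≡ s′ (cell m x)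
    equal = dep (relevant⁺ x∈ y∈ ((refl , sym xy) , ne , agree))
    same : ∀ b → digits s y b ℤ.- digits s x b ≡ digits s′ y b ℤ.- digits s′ x b
    same b rewrite sym xy | equal = refl
  ...   | no ¬agree with FinP.any? (λ b → (toℕ (r (cell m x)) ℕ.<? toℕ b) ×-dec (¬? (R ∋? b)
                          ×-dec ¬? (lowBit m x b BoolP.≟ lowBit m y b)))
  ...     | yes (b , c<b , b∉R , d) = decided-above s s′ {x} {y} (low m b)
    (unmasked λ c c∈ e → b∉R (subst (_∈ R) (FinP.↑ˡ-injective m c b e) c∈)) d
    c<low (subst (λ i → toℕ (r i) ℕ.< toℕ (low m b)) xy c<low)
    where
    c<low : toℕ (r (cell m x)) ℕ.< toℕ (low m b)
    c<low = subst (toℕ (r (cell m x)) ℕ.<_) (sym (FinP.toℕ-↑ˡ b m)) c<b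
  ...     | no none = contradiction agree ¬agree
    where
    agree : Agree R (r (cell m x)) x y
    agree b c<b with R ∋? b | lowBit m x b BoolP.≟ lowBit m y b
    ... | yes b∈ | _     = inj₁ b∈
    ... | no _   | yes e = inj₂ e
    ... | no b∉  | no d  = contradiction (b , c<b , b∉ , d) none

  graph-depends : ∀ Q s s′ → (∀ i → Relevant Q R i (r i) → s i ≡ s′ i) →
                  graph (hFun m R r s) Q ≡ graph (hFun m R r s′) Q
  graph-depends Q s s′ dep = map-cong-local (All.map pair (pairs-∈ Q))
    where
    pair : ∀ {p} → proj₁ p ∈ Q × proj₂ p ∈ Q →
           sgnPair (hFun m R r s) (proj₁ p) (proj₂ p) ≡ sgnPair (hFun m R r s′) (proj₁ p) (proj₂ p)
    pair {x , y} (x∈ , y∈) = sgnPair-sameOrder (hFun m R r s) (hFun m R r s′) x y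
      (order (horner-sameOrder N (digits s x) (digits s y) (digits s′ x) (digits s′ y) decided))
      where
      decided : Decided s s′ x y
      decided with cell m x FinP.≟ cell m y
      ... | yes e = decided-within s s′ {x = x} {y} x∈ y∈ e (dep (cell m x))
      ... | no ne = decided-cross s s′ {x} {y} ne
      3* : ∀ {a b} → a ℤ.< b → + 3 ℤ.* a ℤ.< + 3 ℤ.* b
      3* = ℤP.*-monoˡ-<-pos (+ 3)
      order : SameOrder (horner N (digits s x)) (horner N (digits s y)) (horner N (digits s′ x)) (horner N (digits s′ y)) →
              SameOrder (hFun m R r s x) (hFun m R r s y) (hFun m R r s′ x) (hFun m R r s′ y)
      order o rewrite hFun-horner s x | hFun-horner s y | hFun-horner s′ x | hFun-horner s′ y = case o of λ where
        (inj₁ (p , p′))        → inj₁ (3* p , 3* p′)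
        (inj₂ (inj₁ (p , p′))) → inj₂ (inj₁ (cong (+ 3 ℤ.*_) p , cong (+ 3 ℤ.*_) p′))
        (inj₂ (inj₂ (p , p′))) → inj₂ (inj₂ (3* p , 3* p′))

-- Finite distributions

ℚ-ring : AlmostCommutativeRing 0ℓ 0ℓ
ℚ-ring = fromCommutativeRing ℚP.+-*-commutativeRing (λ _ → nothing)

toℚᵘ-toℚ : ∀ n → toℚᵘ (toℚ n) ℚᵘ.≃ mkℚᵘ (+ n) 0
toℚᵘ-toℚ n = ℚP.toℚᵘ-fromℚᵘ (mkℚᵘ (+ n) 0)

toℚ-+ : ∀ a b → toℚ (a ℕ.+ b) ≡ toℚ a ℚ.+ toℚ b
toℚ-+ a b = ℚP.toℚᵘ-injective (begin
  toℚᵘ (toℚ (a ℕ.+ b))                ≈⟨ toℚᵘ-toℚ (a ℕ.+ b) ⟩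
  mkℚᵘ (+ (a ℕ.+ b)) 0                ≈⟨ *≡* (cong (ℤ._* + 1) (sym (cong₂ ℤ._+_ (ℤP.*-identityʳ (+ a)) (ℤP.*-identityʳ (+ b))))) ⟩
  mkℚᵘ (+ a) 0 ℚᵘ.+ mkℚᵘ (+ b) 0      ≈⟨ ℚᵘP.+-cong (ℚᵘP.≃-sym (toℚᵘ-toℚ a)) (ℚᵘP.≃-sym (toℚᵘ-toℚ b)) ⟩
  toℚᵘ (toℚ a) ℚᵘ.+ toℚᵘ (toℚ b)      ≈⟨ ℚᵘP.≃-sym (ℚP.toℚᵘ-homo-+ (toℚ a) (toℚ b)) ⟩
  toℚᵘ (toℚ a ℚ.+ toℚ b)              ∎)
  where open ℚᵘP.≃-Reasoning

toℚ-* : ∀ a b → toℚ (a ℕ.* b) ≡ toℚ a ℚ.* toℚ b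
toℚ-* a b = ℚP.toℚᵘ-injective (begin
  toℚᵘ (toℚ (a ℕ.* b))                ≈⟨ toℚᵘ-toℚ (a ℕ.* b) ⟩
  mkℚᵘ (+ (a ℕ.* b)) 0                ≈⟨ *≡* (cong (ℤ._* + 1) (ℤP.pos-* a b)) ⟩
  mkℚᵘ (+ a) 0 ℚᵘ.* mkℚᵘ (+ b) 0      ≈⟨ ℚᵘP.*-cong (ℚᵘP.≃-sym (toℚᵘ-toℚ a)) (ℚᵘP.≃-sym (toℚᵘ-toℚ b)) ⟩
  toℚᵘ (toℚ a) ℚᵘ.* toℚᵘ (toℚ b)      ≈⟨ ℚᵘP.≃-sym (ℚP.toℚᵘ-homo-* (toℚ a) (toℚ b)) ⟩
  toℚᵘ (toℚ a ℚ.* toℚ b)              ∎)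
  where open ℚᵘP.≃-Reasoning

toℚ-mono-≤ : ∀ {a b} → a ℕ.≤ b → toℚ a ℚ.≤ toℚ b
toℚ-mono-≤ {a} {b} a≤b = ℚP.toℚᵘ-cancel-≤ (ℚᵘP.≤-trans (ℚᵘP.≤-reflexive (toℚᵘ-toℚ a))
  (ℚᵘP.≤-trans (*≤* (ℤP.*-monoʳ-≤-nonNeg (+ 1) (+≤+ a≤b))) (ℚᵘP.≤-reflexive (ℚᵘP.≃-sym (toℚᵘ-toℚ b)))))

toℚ-nonNeg : ∀ n → ℚ.NonNegative (toℚ n)
toℚ-nonNeg n = ℚ.nonNegative (toℚ-mono-≤ {0} {n} z≤n)

toℚ-pos : ∀ {n} → 0 ℕ.< n → ℚ.Positive (toℚ n)
toℚ-pos {n} 0<n = ℚ.positive (ℚP.<-≤-trans (ℚP.positive⁻¹ 1ℚ) (toℚ-mono-≤ 0<n))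

unit : ℕ → ℚ
unit l = + 1 ℚ./ suc l

unit-* : ∀ l → unit l ℚ.* toℚ (suc l) ≡ 1ℚ
unit-* l = ℚP.toℚᵘ-injective (begin
  toℚᵘ (unit l ℚ.* toℚ (suc l))           ≈⟨ ℚP.toℚᵘ-homo-* (unit l) (toℚ (suc l)) ⟩
  toℚᵘ (unit l) ℚᵘ.* toℚᵘ (toℚ (suc l))   ≈⟨ ℚᵘP.*-cong (ℚP.toℚᵘ-fromℚᵘ (mkℚᵘ (+ 1) l)) (toℚᵘ-toℚ (suc l)) ⟩
  mkℚᵘ (+ 1) l ℚᵘ.* mkℚᵘ (+ suc l) 0      ≈⟨ *≡* (trans (cong (ℤ._* + 1) (ℤP.*-identityˡ (+ suc l)))
                                               (trans (ℤP.*-comm (+ suc l) (+ 1)) (cong (λ z → + 1 ℤ.* + z) (sym (*-identityʳ (suc l)))))) ⟩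
  toℚᵘ 1ℚ                                 ∎)
  where open ℚᵘP.≃-Reasoning

unit-nonNeg : ∀ l → ℚ.NonNegative (unit l)
unit-nonNeg l = ℚP.normalize-nonNeg 1 (suc l)

∑ℚ : List A → (A → ℚ) → ℚ
∑ℚ xs f = sumℚ (map f xs)

∑ℚ-cong : (xs : List A) {f g : A → ℚ} → (∀ x → f x ≡ g x) → ∑ℚ xs f ≡ ∑ℚ xs g
∑ℚ-cong xs h = cong sumℚ (map-cong h xs)

∑ℚ-mono : (xs : List A) {f g : A → ℚ} → (∀ x → f x ℚ.≤ g x) → ∑ℚ xs f ℚ.≤ ∑ℚ xs g
∑ℚ-mono []       h = ℚP.≤-refl
∑ℚ-mono (x ∷ xs) h = ℚP.+-mono-≤ (h x) (∑ℚ-mono xs h)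

∑ℚ-++ : (xs ys : List A) (f : A → ℚ) → ∑ℚ (xs ++ ys) f ≡ ∑ℚ xs f ℚ.+ ∑ℚ ys f
∑ℚ-++ []       ys f = sym (ℚP.+-identityˡ _)
∑ℚ-++ (x ∷ xs) ys f = trans (cong (f x ℚ.+_) (∑ℚ-++ xs ys f)) (sym (ℚP.+-assoc (f x) _ _))

∑ℚ-map : (g : A → B) (xs : List A) (f : B → ℚ) → ∑ℚ (map g xs) f ≡ ∑ℚ xs (f ∘ g)
∑ℚ-map g xs f = cong sumℚ (sym (map-∘ xs))

∑ℚ-*ˡ : (xs : List A) (c : ℚ) (f : A → ℚ) → ∑ℚ xs (λ x → c ℚ.* f x) ≡ c ℚ.* ∑ℚ xs f
∑ℚ-*ˡ []       c f = sym (ℚP.*-zeroʳ c)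
∑ℚ-*ˡ (x ∷ xs) c f = trans (cong (c ℚ.* f x ℚ.+_) (∑ℚ-*ˡ xs c f)) (sym (ℚP.*-distribˡ-+ c (f x) _))

interchange : ∀ a b c d → (a ℚ.+ b) ℚ.+ (c ℚ.+ d) ≡ (a ℚ.+ c) ℚ.+ (b ℚ.+ d)
interchange = RingSolver.solve-∀ ℚ-ring

∑ℚ-+ : (xs : List A) (f g : A → ℚ) → ∑ℚ xs (λ x → f x ℚ.+ g x) ≡ ∑ℚ xs f ℚ.+ ∑ℚ xs g
∑ℚ-+ []       f g = sym (ℚP.+-identityˡ 0ℚ)
∑ℚ-+ (x ∷ xs) f g = trans (cong (f x ℚ.+ g x ℚ.+_) (∑ℚ-+ xs f g)) (interchange (f x) (g x) _ _)

∑ℚ-0 : (xs : List A) → ∑ℚ xs (λ _ → 0ℚ) ≡ 0ℚ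
∑ℚ-0 []       = refl
∑ℚ-0 (x ∷ xs) = trans (ℚP.+-identityˡ _) (∑ℚ-0 xs)

∑ℚ-swap : (xs : List A) (ys : List B) (f : A → B → ℚ) →
          ∑ℚ xs (λ x → ∑ℚ ys (f x)) ≡ ∑ℚ ys (λ y → ∑ℚ xs (λ x → f x y))
∑ℚ-swap []       ys f = sym (∑ℚ-0 ys)
∑ℚ-swap (x ∷ xs) ys f = trans (cong (∑ℚ ys (f x) ℚ.+_) (∑ℚ-swap xs ys f)) (sym (∑ℚ-+ ys (f x) _))

∑ℚ-toℚ : (xs : List A) (f : A → ℕ) → ∑ℚ xs (toℚ ∘ f) ≡ toℚ (∑ xs f)
∑ℚ-toℚ []       f = refl
∑ℚ-toℚ (x ∷ xs) f = trans (cong (toℚ (f x) ℚ.+_) (∑ℚ-toℚ xs f)) (sym (toℚ-+ (f x) (∑ xs f)))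

Ex : Dist A → (A → ℚ) → ℚ
Ex μ φ = ∑ℚ μ (λ p → proj₁ p ℚ.* φ (proj₂ p))

Weights≥0 : Dist A → Set
Weights≥0 = All (λ p → ℚ.NonNegative (proj₁ p))

Ex-cong : (μ : Dist A) {φ ψ : A → ℚ} → (∀ a → φ a ≡ ψ a) → Ex μ φ ≡ Ex μ ψ
Ex-cong μ h = ∑ℚ-cong μ (λ p → cong (proj₁ p ℚ.*_) (h (proj₂ p)))

Ex-mono : {μ : Dist A} → Weights≥0 μ → {φ ψ : A → ℚ} → (∀ a → φ a ℚ.≤ ψ a) → Ex μ φ ℚ.≤ Ex μ ψ
Ex-mono []                          h = ℚP.≤-refl
Ex-mono {μ = (q , a) ∷ μ} (q≥0 ∷ w) h = ℚP.+-mono-≤ (ℚP.*-monoˡ-≤-nonNeg q {{q≥0}} (h a)) (Ex-mono w h)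

Ex-*ˡ : (μ : Dist A) (c : ℚ) (φ : A → ℚ) → Ex μ (λ a → c ℚ.* φ a) ≡ c ℚ.* Ex μ φ
Ex-*ˡ μ c φ = trans (∑ℚ-cong μ (λ p → perm (proj₁ p) c (φ (proj₂ p)))) (∑ℚ-*ˡ μ c _)
  where
  perm : ∀ a b c → a ℚ.* (b ℚ.* c) ≡ b ℚ.* (a ℚ.* c)
  perm = RingSolver.solve-∀ ℚ-ring

Ex-+ : (μ : Dist A) (φ ψ : A → ℚ) → Ex μ (λ a → φ a ℚ.+ ψ a) ≡ Ex μ φ ℚ.+ Ex μ ψ
Ex-+ μ φ ψ = trans (∑ℚ-cong μ (λ p → ℚP.*-distribˡ-+ (proj₁ p) (φ (proj₂ p)) (ψ (proj₂ p)))) (∑ℚ-+ μ _ _)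

Ex-neg : (μ : Dist A) (φ : A → ℚ) → Ex μ (λ a → ℚ.- φ a) ≡ ℚ.- Ex μ φ
Ex-neg []            φ = refl
Ex-neg ((q , a) ∷ μ) φ = trans (cong₂ ℚ._+_ (sym (ℚP.neg-distribʳ-* q (φ a))) (Ex-neg μ φ))
  (sym (ℚP.neg-distrib-+ (q ℚ.* φ a) (Ex μ φ)))

Ex-∑ℚ : (μ : Dist A) (L : List B) (φ : B → A → ℚ) →
        ∑ℚ L (λ o → Ex μ (φ o)) ≡ Ex μ (λ a → ∑ℚ L (λ o → φ o a))
Ex-∑ℚ μ L φ = trans (∑ℚ-swap L μ _) (∑ℚ-cong μ (λ p → ∑ℚ-*ˡ L (proj₁ p) _))

Ex->>= : (μ : Dist A) (K : A → Dist B) (φ : B → ℚ) → Ex (μ >>= K) φ ≡ Ex μ (λ a → Ex (K a) φ)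
Ex->>= []            K φ = refl
Ex->>= ((q , a) ∷ μ) K φ = trans (∑ℚ-++ (map _ (K a)) (μ >>= K) _) (cong₂ ℚ._+_ scale (Ex->>= μ K φ))
  where
  scale : Ex (map (λ p → (q ℚ.* proj₁ p) , proj₂ p) (K a)) φ ≡ q ℚ.* Ex (K a) φ
  scale = trans (∑ℚ-map (λ p → (q ℚ.* proj₁ p) , proj₂ p) (K a) (λ p → proj₁ p ℚ.* φ (proj₂ p)))
    (trans (∑ℚ-cong (K a) (λ p → ℚP.*-assoc q (proj₁ p) (φ (proj₂ p)))) (∑ℚ-*ˡ (K a) q _))

Ex-return : (a : A) (φ : A → ℚ) → Ex (return a) φ ≡ φ a
Ex-return a φ = trans (ℚP.+-identityʳ _) (ℚP.*-identityˡ (φ a))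

weights-uniform : (xs : List A) → Weights≥0 (uniform xs)
weights-uniform []       = []
weights-uniform (x ∷ xs) = AllP.map⁺ (All.universal (λ _ → unit-nonNeg (length xs)) (x ∷ xs))

weights->>= : {μ : Dist A} {K : A → Dist B} → Weights≥0 μ → (∀ a → Weights≥0 (K a)) → Weights≥0 (μ >>= K)
weights->>= []                          k = []
weights->>= {μ = (q , a) ∷ μ} (q≥0 ∷ w) k = AllP.++⁺
  (AllP.map⁺ (All.map (λ {p} p≥0 → ℚP.nonNeg*nonNeg⇒nonNeg q {{q≥0}} (proj₁ p) {{p≥0}}) (k a)))
  (weights->>= w k)

weights-return : (a : A) → Weights≥0 (return a)
weights-return a = _ ∷ []

Ex-uniform : (x : A) (xs : List A) (φ : A → ℚ) → Ex (uniform (x ∷ xs)) φ ≡ unit (length xs) ℚ.* ∑ℚ (x ∷ xs) φ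
Ex-uniform x xs φ = trans
  (∑ℚ-map (unit (length xs) ,_) (x ∷ xs) (λ p → proj₁ p ℚ.* φ (proj₂ p))) (∑ℚ-*ˡ (x ∷ xs) (unit (length xs)) φ)

Ex-uniform-∑ : (xs : List A) {f g : A → ℕ} → ∑ xs f ≡ ∑ xs g → Ex (uniform xs) (toℚ ∘ f) ≡ Ex (uniform xs) (toℚ ∘ g)
Ex-uniform-∑ []       e = refl
Ex-uniform-∑ (x ∷ xs) {f} {g} e = begin
  Ex (uniform (x ∷ xs)) (toℚ ∘ f)            ≡⟨ Ex-uniform x xs (toℚ ∘ f) ⟩
  unit (length xs) ℚ.* ∑ℚ (x ∷ xs) (toℚ ∘ f) ≡⟨ cong (unit (length xs) ℚ.*_) (trans (∑ℚ-toℚ (x ∷ xs) f) (trans (cong toℚ e) (sym (∑ℚ-toℚ (x ∷ xs) g)))) ⟩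
  unit (length xs) ℚ.* ∑ℚ (x ∷ xs) (toℚ ∘ g) ≡⟨ sym (Ex-uniform x xs (toℚ ∘ g)) ⟩
  Ex (uniform (x ∷ xs)) (toℚ ∘ g)            ∎
  where open ≡-Reasoning

∑ℚ-const : (xs : List A) (c : ℚ) → ∑ℚ xs (λ _ → c) ≡ toℚ (length xs) ℚ.* c
∑ℚ-const []       c = sym (ℚP.*-zeroˡ c)
∑ℚ-const (x ∷ xs) c = begin
  c ℚ.+ ∑ℚ xs (λ _ → c)                 ≡⟨ cong₂ ℚ._+_ (sym (ℚP.*-identityˡ c)) (∑ℚ-const xs c) ⟩
  1ℚ ℚ.* c ℚ.+ toℚ (length xs) ℚ.* c    ≡⟨ sym (ℚP.*-distribʳ-+ c 1ℚ (toℚ (length xs))) ⟩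
  (1ℚ ℚ.+ toℚ (length xs)) ℚ.* c        ≡⟨ cong (ℚ._* c) (sym (toℚ-+ 1 (length xs))) ⟩
  toℚ (suc (length xs)) ℚ.* c           ∎
  where open ≡-Reasoning

Ex-uniform-const : (xs : List A) (c : ℚ) → 0 ℕ.< length xs → Ex (uniform xs) (λ _ → c) ≡ c
Ex-uniform-const (x ∷ xs) c _ = begin
  Ex (uniform (x ∷ xs)) (λ _ → c)        ≡⟨ Ex-uniform x xs (λ _ → c) ⟩
  w ℚ.* ∑ℚ (x ∷ xs) (λ _ → c)            ≡⟨ cong (w ℚ.*_) (∑ℚ-const (x ∷ xs) c) ⟩
  w ℚ.* (toℚ (suc (length xs)) ℚ.* c)    ≡⟨ sym (ℚP.*-assoc w (toℚ (suc (length xs))) c) ⟩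
  (w ℚ.* toℚ (suc (length xs))) ℚ.* c    ≡⟨ cong (ℚ._* c) (unit-* (length xs)) ⟩
  1ℚ ℚ.* c                               ≡⟨ ℚP.*-identityˡ c ⟩
  c                                      ∎
  where
  open ≡-Reasoning
  w = unit (length xs)

-- The passage from counts to expectations: b · a · E[g] ≤ N. It is applied three times, averaging
-- over r, over R and over k; the bound obtained at one layer is the pointwise hypothesis at the
-- next.
Ex-uniform-bound : (xs : List A) (g : A → ℚ) (f : A → ℕ) (a b N : ℕ) →
  (∀ x → x ∈ xs → toℚ a ℚ.* g x ℚ.≤ toℚ (f x)) → b ℕ.* ∑ xs f ℕ.≤ length xs ℕ.* N →
  toℚ (b ℕ.* a) ℚ.* Ex (uniform xs) g ℚ.≤ toℚ N
Ex-uniform-bound []       g f a b N _ _  =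
  ℚP.≤-trans (ℚP.≤-reflexive (ℚP.*-zeroʳ (toℚ (b ℕ.* a)))) (toℚ-mono-≤ {0} {N} z≤n)
Ex-uniform-bound (x ∷ xs) g f a b N h le = begin
  toℚ (b ℕ.* a) ℚ.* Ex (uniform (x ∷ xs)) g     ≡⟨ cong₂ ℚ._*_ (toℚ-* b a) (Ex-uniform x xs g) ⟩
  (toℚ b ℚ.* toℚ a) ℚ.* (w ℚ.* ∑ℚ (x ∷ xs) g)   ≡⟨ perm (toℚ b) (toℚ a) w (∑ℚ (x ∷ xs) g) ⟩
  w ℚ.* (toℚ b ℚ.* (toℚ a ℚ.* ∑ℚ (x ∷ xs) g))   ≤⟨ ℚP.*-monoˡ-≤-nonNeg w {{unit-nonNeg l}} (ℚP.*-monoˡ-≤-nonNeg (toℚ b) {{toℚ-nonNeg b}} (sums (x ∷ xs) h)) ⟩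
  w ℚ.* (toℚ b ℚ.* toℚ (∑ (x ∷ xs) f))          ≡⟨ cong (w ℚ.*_) (sym (toℚ-* b (∑ (x ∷ xs) f))) ⟩
  w ℚ.* toℚ (b ℕ.* ∑ (x ∷ xs) f)                ≤⟨ ℚP.*-monoˡ-≤-nonNeg w {{unit-nonNeg l}} (toℚ-mono-≤ le) ⟩
  w ℚ.* toℚ (suc l ℕ.* N)                       ≡⟨ trans (cong (w ℚ.*_) (toℚ-* (suc l) N)) (sym (ℚP.*-assoc w (toℚ (suc l)) (toℚ N))) ⟩
  (w ℚ.* toℚ (suc l)) ℚ.* toℚ N                 ≡⟨ trans (cong (ℚ._* toℚ N) (unit-* l)) (ℚP.*-identityˡ (toℚ N)) ⟩
  toℚ N                                         ∎
  where
  open ℚP.≤-Reasoning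
  l = length xs
  w = unit l
  perm : ∀ b a w s → (b ℚ.* a) ℚ.* (w ℚ.* s) ≡ w ℚ.* (b ℚ.* (a ℚ.* s))
  perm = RingSolver.solve-∀ ℚ-ring
  sums : ∀ ys → (∀ y → y ∈ ys → toℚ a ℚ.* g y ℚ.≤ toℚ (f y)) → toℚ a ℚ.* ∑ℚ ys g ℚ.≤ toℚ (∑ ys f)
  sums []       h = ℚP.≤-reflexive (ℚP.*-zeroʳ (toℚ a))
  sums (y ∷ ys) h = begin
    toℚ a ℚ.* (g y ℚ.+ ∑ℚ ys g)               ≡⟨ ℚP.*-distribˡ-+ (toℚ a) (g y) _ ⟩
    toℚ a ℚ.* g y ℚ.+ toℚ a ℚ.* ∑ℚ ys g       ≤⟨ ℚP.+-mono-≤ (h y (here refl)) (sums ys (λ z z∈ → h z (there z∈))) ⟩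
    toℚ (f y) ℚ.+ toℚ (∑ ys f)                ≡⟨ sym (toℚ-+ (f y) (∑ ys f)) ⟩
    toℚ (∑ (y ∷ ys) f)                        ∎

-- Total variation distance of mixtures.

module _ (_≟_ : DecidableEquality A) where

  prob-Ex : (μ : Dist A) (a : A) → prob _≟_ μ a ≡ Ex μ (λ b → toℚ (ind (b ≟ a)))
  prob-Ex []            a = refl
  prob-Ex ((q , b) ∷ μ) a with b ≟ a
  ... | yes _ = cong₂ ℚ._+_ (sym (ℚP.*-identityʳ q)) (prob-Ex μ a)
  ... | no _  = cong₂ ℚ._+_ (sym (ℚP.*-zeroʳ q)) (prob-Ex μ a)

  ∑ℚ-prob≤1 : {L : List A} → Unique L → {μ : Dist A} → Weights≥0 μ → Ex μ (λ _ → 1ℚ) ℚ.≤ 1ℚ →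
              ∑ℚ L (prob _≟_ μ) ℚ.≤ 1ℚ
  ∑ℚ-prob≤1 {L} u {μ} w mass = begin
    ∑ℚ L (prob _≟_ μ)                              ≡⟨ ∑ℚ-cong L (prob-Ex μ) ⟩
    ∑ℚ L (λ o → Ex μ (λ b → toℚ (ind (b ≟ o))))    ≡⟨ Ex-∑ℚ μ L _ ⟩
    Ex μ (λ b → ∑ℚ L (λ o → toℚ (ind (b ≟ o))))    ≤⟨ Ex-mono w once ⟩
    Ex μ (λ _ → 1ℚ)                                ≤⟨ mass ⟩
    1ℚ                                             ∎
    where
    open ℚP.≤-Reasoning
    once : ∀ b → ∑ℚ L (λ o → toℚ (ind (b ≟ o))) ℚ.≤ 1ℚ
    once b = ℚP.≤-trans (ℚP.≤-reflexive (∑ℚ-toℚ L (λ o → ind (b ≟ o)))) (toℚ-mono-≤ {∑ L (λ o → ind (b ≟ o))} {1} (∑-≤1 u (λ o → ind (b ≟ o))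
      (λ o → ind≤1 (b ≟ o)) (λ o o′ p q → trans (sym (ind-pos (b ≟ o) p)) (ind-pos (b ≟ o′) q))))

  -- Conditionally on ω, a good outcome contributes nothing, and a bad one contributes at most the
  -- sum of two total masses, that is 2, which the factor ½ in `tv` compensates.
  tv-mixture : {Ω : Set} {μ : Dist Ω} (ν ν′ : Ω → Dist A) {Bad : Ω → Set} (bad? : ∀ ω → Dec (Bad ω)) →
    Weights≥0 μ → (∀ ω → Weights≥0 (ν ω)) → (∀ ω → Weights≥0 (ν′ ω)) →
    (∀ ω → Ex (ν ω) (λ _ → 1ℚ) ℚ.≤ 1ℚ) → (∀ ω → Ex (ν′ ω) (λ _ → 1ℚ) ℚ.≤ 1ℚ) →
    (∀ ω → ¬ Bad ω → ∀ o → prob _≟_ (ν ω) o ≡ prob _≟_ (ν′ ω) o) →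
    (γ γ′ : Dist A) → (∀ o → prob _≟_ γ o ≡ Ex μ (λ ω → prob _≟_ (ν ω) o)) →
    (∀ o → prob _≟_ γ′ o ≡ Ex μ (λ ω → prob _≟_ (ν′ ω) o)) →
    tv _≟_ γ γ′ ℚ.≤ Ex μ (λ ω → toℚ (ind (bad? ω)))
  tv-mixture {μ = μ} ν ν′ bad? w wν wν′ mν mν′ good γ γ′ eγ eγ′ = begin
    ½ ℚ.* ∑ℚ L (λ o → ℚ.∣ prob _≟_ γ o ℚ.- prob _≟_ γ′ o ∣)
      ≤⟨ ℚP.*-monoˡ-≤-nonNeg ½ (∑ℚ-mono L difference) ⟩
    ½ ℚ.* ∑ℚ L (λ o → Ex μ (λ ω → b ω ℚ.* (p ω o ℚ.+ p′ ω o)))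
      ≡⟨ cong (½ ℚ.*_) (Ex-∑ℚ μ L _) ⟩
    ½ ℚ.* Ex μ (λ ω → ∑ℚ L (λ o → b ω ℚ.* (p ω o ℚ.+ p′ ω o)))
      ≤⟨ ℚP.*-monoˡ-≤-nonNeg ½ (Ex-mono w total) ⟩
    ½ ℚ.* Ex μ (λ ω → toℚ 2 ℚ.* b ω)
      ≡⟨ cong (½ ℚ.*_) (Ex-*ˡ μ (toℚ 2) b) ⟩
    ½ ℚ.* (toℚ 2 ℚ.* Ex μ b)
      ≡⟨ trans (sym (ℚP.*-assoc ½ (toℚ 2) (Ex μ b))) (ℚP.*-identityˡ (Ex μ b)) ⟩
    Ex μ b ∎
    where
    open ℚP.≤-Reasoning
    L = deduplicate _≟_ (map proj₂ γ ++ map proj₂ γ′)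
    uL : Unique L
    uL = deduplicate-! _≟_ (map proj₂ γ ++ map proj₂ γ′)
    b : _ → ℚ
    b ω = toℚ (ind (bad? ω))
    p p′ : _ → A → ℚ
    p  ω o = prob _≟_ (ν ω) o
    p′ ω o = prob _≟_ (ν′ ω) o
    prob≥0 : ∀ {μ} → Weights≥0 μ → ∀ o → 0ℚ ℚ.≤ prob _≟_ μ o
    prob≥0 {μ} w o = ℚP.≤-trans
      (ℚP.≤-reflexive (sym (trans (∑ℚ-cong μ (λ p → ℚP.*-zeroʳ (proj₁ p))) (∑ℚ-0 μ))))
      (ℚP.≤-trans (Ex-mono w (λ a → toℚ-mono-≤ {0} {ind (a ≟ o)} z≤n)) (ℚP.≤-reflexive (sym (prob-Ex μ o))))
    pointwise : ∀ o ω → ℚ.∣ p ω o ℚ.- p′ ω o ∣ ℚ.≤ b ω ℚ.* (p ω o ℚ.+ p′ ω o)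
    pointwise o ω with bad? ω
    ... | no ¬bad = ℚP.≤-reflexive (trans
      (cong ℚ.∣_∣ (trans (cong (ℚ._- p′ ω o) (good ω ¬bad o)) (ℚP.+-inverseʳ (p′ ω o))))
      (sym (ℚP.*-zeroˡ (p ω o ℚ.+ p′ ω o))))
    ... | yes _   = begin
      ℚ.∣ p ω o ℚ.- p′ ω o ∣             ≤⟨ ℚP.∣p-q∣≤∣p∣+∣q∣ (p ω o) (p′ ω o) ⟩
      ℚ.∣ p ω o ∣ ℚ.+ ℚ.∣ p′ ω o ∣       ≡⟨ cong₂ ℚ._+_ (ℚP.0≤p⇒∣p∣≡p (prob≥0 (wν ω) o)) (ℚP.0≤p⇒∣p∣≡p (prob≥0 (wν′ ω) o)) ⟩
      p ω o ℚ.+ p′ ω o                   ≡⟨ sym (ℚP.*-identityˡ _) ⟩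
      1ℚ ℚ.* (p ω o ℚ.+ p′ ω o)          ∎
    abs-Ex : ∀ {μ} → Weights≥0 μ → ∀ φ → ℚ.∣ Ex μ φ ∣ ℚ.≤ Ex μ (λ ω → ℚ.∣ φ ω ∣)
    abs-Ex []                           φ = ℚP.≤-refl
    abs-Ex {(q , a) ∷ μ} (q≥0 ∷ w) φ = ℚP.≤-trans (ℚP.∣p+q∣≤∣p∣+∣q∣ (q ℚ.* φ a) (Ex μ φ))
      (ℚP.+-mono-≤ (ℚP.≤-reflexive (trans (ℚP.∣p*q∣≡∣p∣*∣q∣ q (φ a))
        (cong (ℚ._* ℚ.∣ φ a ∣) (ℚP.0≤p⇒∣p∣≡p (ℚP.nonNegative⁻¹ q {{q≥0}}))))) (abs-Ex w φ))
    subtract : ∀ o → prob _≟_ γ o ℚ.- prob _≟_ γ′ o ≡ Ex μ (λ ω → p ω o ℚ.- p′ ω o)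
    subtract o = sym (trans (Ex-+ μ (λ ω → p ω o) (λ ω → ℚ.- p′ ω o))
      (cong₂ ℚ._+_ (sym (eγ o)) (trans (Ex-neg μ (λ ω → p′ ω o)) (cong ℚ.-_ (sym (eγ′ o))))))
    difference : ∀ o → ℚ.∣ prob _≟_ γ o ℚ.- prob _≟_ γ′ o ∣ ℚ.≤ Ex μ (λ ω → b ω ℚ.* (p ω o ℚ.+ p′ ω o))
    difference o = begin
      ℚ.∣ prob _≟_ γ o ℚ.- prob _≟_ γ′ o ∣          ≡⟨ cong ℚ.∣_∣ (subtract o) ⟩
      ℚ.∣ Ex μ (λ ω → p ω o ℚ.- p′ ω o) ∣           ≤⟨ abs-Ex w (λ ω → p ω o ℚ.- p′ ω o) ⟩
      Ex μ (λ ω → ℚ.∣ p ω o ℚ.- p′ ω o ∣)           ≤⟨ Ex-mono w (pointwise o) ⟩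
      Ex μ (λ ω → b ω ℚ.* (p ω o ℚ.+ p′ ω o))       ∎
    total : ∀ ω → ∑ℚ L (λ o → b ω ℚ.* (p ω o ℚ.+ p′ ω o)) ℚ.≤ toℚ 2 ℚ.* b ω
    total ω = begin
      ∑ℚ L (λ o → b ω ℚ.* (p ω o ℚ.+ p′ ω o))       ≡⟨ ∑ℚ-*ˡ L (b ω) _ ⟩
      b ω ℚ.* ∑ℚ L (λ o → p ω o ℚ.+ p′ ω o)         ≡⟨ cong (b ω ℚ.*_) (∑ℚ-+ L (p ω) (p′ ω)) ⟩
      b ω ℚ.* (∑ℚ L (p ω) ℚ.+ ∑ℚ L (p′ ω))          ≤⟨ ℚP.*-monoˡ-≤-nonNeg (b ω) {{toℚ-nonNeg (ind (bad? ω))}}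
                                                        (ℚP.+-mono-≤ (∑ℚ-prob≤1 uL (wν ω) (mν ω)) (∑ℚ-prob≤1 uL (wν′ ω) (mν′ ω))) ⟩
      b ω ℚ.* toℚ 2                                 ≡⟨ ℚP.*-comm (b ω) (toℚ 2) ⟩
      toℚ 2 ℚ.* b ω                                 ∎

-- Sampling the graph as a mixture over k, R and r.

_≟g_ : DecidableEquality (List ℤ)
_≟g_ = ListP.≡-dec ℤ._≟_

Family : ℕ → Set
Family m = List (Fin (dim m)) → (Fin (dim m) → Fin (dim m))
         → (Fin (dim m) → Bool) → (Fin (dim m) → Bool) → Point m → ℤ

-- The draws other than α and β. They already determine whether relevant cells collide, so one can
-- condition on them and compare the laws of the signs alone.
Choice : ℕ → Set
Choice m = ℕ × List (Fin (dim m)) × (Fin (dim m) → Fin (dim m))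

choices : ∀ m → Dist (Choice m)
choices m = uniform (ks m) >>= λ k → uniform (subsetsOfSize (dim m) (2 ^ k)) >>= λ R →
            uniform (allFuns (dim m) R) >>= λ r → return (k , R , r)

signs : ∀ m → Family m → List (Point m) → Choice m → Dist (List ℤ)
signs m F Q (k , R , r) = uniform (allFuns (dim m) bools) >>= λ α →
  uniform (allFuns (dim m) bools) >>= λ β → return (graph (F R r α β) Q)

Ex-choices : ∀ m (ψ : Choice m → ℚ) → Ex (choices m) ψ ≡
  Ex (uniform (ks m)) (λ k → Ex (uniform (subsetsOfSize (dim m) (2 ^ k))) (λ R →
    Ex (uniform (allFuns (dim m) R)) (λ r → ψ (k , R , r))))
Ex-choices m ψ = trans (Ex->>= (uniform (ks m)) _ ψ) (Ex-cong (uniform (ks m)) λ k →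
  trans (Ex->>= (uniform (subsetsOfSize (dim m) (2 ^ k))) _ ψ) (Ex-cong (uniform (subsetsOfSize (dim m) (2 ^ k))) λ R →
  trans (Ex->>= (uniform (allFuns (dim m) R)) _ ψ) (Ex-cong (uniform (allFuns (dim m) R)) λ r →
  Ex-return (k , R , r) ψ)))

Ex-signs : ∀ m F Q ((k , R , r) : Choice m) (φ : List ℤ → ℚ) → Ex (signs m F Q (k , R , r)) φ ≡
  Ex (uniform (allFuns (dim m) bools)) (λ α → Ex (uniform (allFuns (dim m) bools)) (λ β → φ (graph (F R r α β) Q)))
Ex-signs m F Q (k , R , r) φ = trans (Ex->>= Bs _ φ) (Ex-cong Bs λ α →
  trans (Ex->>= Bs _ φ) (Ex-cong Bs λ β → Ex-return (graph (F R r α β) Q) φ))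
  where Bs = uniform (allFuns (dim m) bools)

-- Regrouping of the nested draws, stated through expectations because `prob` is itself an
-- expectation.
Ex-sampleGraph : ∀ m F Q (φ : List ℤ → ℚ) →
  Ex (sampleGraph m F Q) φ ≡ Ex (choices m) (λ ω → Ex (signs m F Q ω) φ)
Ex-sampleGraph m F Q φ = trans
  (trans (Ex->>= (uniform (ks m)) _ φ) (Ex-cong (uniform (ks m)) λ k →
    trans (Ex->>= (uniform (subsetsOfSize (dim m) (2 ^ k))) _ φ) (Ex-cong (uniform (subsetsOfSize (dim m) (2 ^ k))) λ R →
    Ex->>= (uniform (allFuns (dim m) R)) (λ r → signs m F Q (k , R , r)) φ)))
  (sym (Ex-choices m (λ ω → Ex (signs m F Q ω) φ)))

weights-choices : ∀ m → Weights≥0 (choices m)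
weights-choices m = weights->>= (weights-uniform (ks m)) λ k →
  weights->>= (weights-uniform (subsetsOfSize (dim m) (2 ^ k))) λ R →
  weights->>= (weights-uniform (allFuns (dim m) R)) λ r → weights-return (k , R , r)

weights-signs : ∀ m F Q ω → Weights≥0 (signs m F Q ω)
weights-signs m F Q (k , R , r) = weights->>= (weights-uniform (allFuns (dim m) bools)) λ α →
  weights->>= (weights-uniform (allFuns (dim m) bools)) λ β → weights-return (graph (F R r α β) Q)

bools-nonempty : ∀ n → 0 < length (allFuns n bools)
bools-nonempty n = subst (0 <_) (sym (length-allFuns n bools)) (m^n>0 2 n)

Ex-signs-1 : ∀ m F Q ω → Ex (signs m F Q ω) (λ _ → 1ℚ) ≤ℚ 1ℚ
Ex-signs-1 m F Q ω = ℚP.≤-reflexive (trans (Ex-signs m F Q ω (λ _ → 1ℚ))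
  (trans (Ex-cong Bs (λ _ → Ex-uniform-const (allFuns (dim m) bools) 1ℚ (bools-nonempty (dim m))))
         (Ex-uniform-const (allFuns (dim m) bools) 1ℚ (bools-nonempty (dim m)))))
  where Bs = uniform (allFuns (dim m) bools)

-- Multiplies an inequality with cleared denominators by v / u, the common ratio of A to A′ and of N
-- to N′.
rescale : ∀ u v A A′ N N′ (g : ℚ) → 0 < u → u * A ≡ v * A′ → u * N ≡ v * N′ →
          toℚ A′ *ℚ g ≤ℚ toℚ N′ → toℚ A *ℚ g ≤ℚ toℚ N
rescale u v A A′ N N′ g u>0 eA eN le = ℚP.*-cancelˡ-≤-pos (toℚ u) {{toℚ-pos u>0}} (begin
  toℚ u *ℚ (toℚ A *ℚ g)    ≡⟨ pull u A ⟩
  toℚ (u * A) *ℚ g         ≡⟨ cong (λ z → toℚ z *ℚ g) eA ⟩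
  toℚ (v * A′) *ℚ g        ≡⟨ sym (pull v A′) ⟩
  toℚ v *ℚ (toℚ A′ *ℚ g)   ≤⟨ ℚP.*-monoˡ-≤-nonNeg (toℚ v) {{toℚ-nonNeg v}} le ⟩
  toℚ v *ℚ toℚ N′          ≡⟨ sym (toℚ-* v N′) ⟩
  toℚ (v * N′)             ≡⟨ cong toℚ (sym eN) ⟩
  toℚ (u * N)              ≡⟨ toℚ-* u N ⟩
  toℚ u *ℚ toℚ N           ∎)
  where
  open ℚP.≤-Reasoning
  pull : ∀ a b → toℚ a *ℚ (toℚ b *ℚ g) ≡ toℚ (a * b) *ℚ g
  pull a b = trans (sym (ℚP.*-assoc (toℚ a) (toℚ b) g)) (cong (_*ℚ g) (sym (toℚ-* a b)))

-- The collision probability as a bound on the distance.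

module _ (m : ℕ) (Q : List (Point m)) where
  open Relevance (cell m) (lowBit m)

  private
    d = dim m
    K = m ℕ./ 2
    S = 2 ^ K

  Collides : Choice m → Set
  Collides (k , R , r) = Collision Q R r

  collides? : ∀ ω → Dec (Collides ω)
  collides? (k , R , r) = collision? Q R r

  -- Without a collision, r is injective on the relevant cells, so by `∑Bool-pullback` the signs α ∘
  -- r and β have the same law on the cells that the graph can see. On each side the other sign
  -- vector averages out.
  signs-agree : ∀ ω → ¬ Collides ω → ∀ o →
    prob _≟g_ (signs m (fY m) Q ω) o ≡ prob _≟g_ (signs m (gN m) Q ω) o
  signs-agree ω@(k , R , r) none o = begin
    prob _≟g_ (signs m (fY m) Q ω) o                        ≡⟨ prob-Ex _≟g_ (signs m (fY m) Q ω) o ⟩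
    Ex (signs m (fY m) Q ω) φ                               ≡⟨ Ex-signs m (fY m) Q ω φ ⟩
    Ex Bs (λ α → Ex Bs (λ β → toℚ (G (α ∘ r))))             ≡⟨ Ex-cong Bs (λ α → Ex-uniform-const bs (toℚ (G (α ∘ r))) (bools-nonempty d)) ⟩
    Ex Bs (λ α → toℚ (G (α ∘ r)))                           ≡⟨ Ex-uniform-∑ bs (sym pullback) ⟩
    Ex Bs (λ β → toℚ (G β))                                 ≡⟨ sym (Ex-uniform-const bs _ (bools-nonempty d)) ⟩
    Ex Bs (λ α → Ex Bs (λ β → toℚ (G β)))                   ≡⟨ sym (Ex-signs m (gN m) Q ω φ) ⟩
    Ex (signs m (gN m) Q ω) φ                               ≡⟨ sym (prob-Ex _≟g_ (signs m (gN m) Q ω) o) ⟩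
    prob _≟g_ (signs m (gN m) Q ω) o                        ∎
    where
    open ≡-Reasoning
    bs = allFuns d bools
    Bs = uniform bs
    φ : List ℤ → ℚ
    φ g = toℚ (ind (g ≟g o))
    G : (Fin d → Bool) → ℕ
    G s = ind (graph (hFun m R r s) Q ≟g o)
    injective : ∀ i j → Relevant Q R i (r i) → Relevant Q R j (r j) → r i ≡ r j → i ≡ j
    injective i j reli relj e with i FinP.≟ j
    ... | yes i≡j = i≡j
    ... | no i≢j  = contradiction (i , j , i≢j , e , reli , relj) none
    pullback : ∑Bool d G ≡ ∑Bool d (λ α → G (α ∘ r))
    pullback = *-cancelˡ-≡ _ _ (2 ^ d) {{m^n≢0 2 d}}
      (∑Bool-pullback d d (λ i → Relevant Q R i (r i)) (λ i → relevant? Q R i (r i)) r injective G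
        (λ s s′ h → cong (λ g → ind (g ≟g o)) (graph-depends m R r Q s s′ h)))

  tv≤collision : tvGraphs m Q ≤ℚ Ex (choices m) (λ ω → toℚ (ind (collides? ω)))
  tv≤collision = tv-mixture _≟g_ (signs m (fY m) Q) (signs m (gN m) Q) collides?
    (weights-choices m) (weights-signs m (fY m) Q) (weights-signs m (gN m) Q)
    (Ex-signs-1 m (fY m) Q) (Ex-signs-1 m (gN m) Q) signs-agree (GY m Q) (GN m Q)
    (mixture (fY m)) (mixture (gN m))
    where
    mixture : ∀ F o → prob _≟g_ (sampleGraph m F Q) o
                    ≡ Ex (choices m) (λ ω → prob _≟g_ (signs m F Q ω) o)
    mixture F o = trans (prob-Ex _≟g_ (sampleGraph m F Q) o) (trans (Ex-sampleGraph m F Q (λ g → toℚ (ind (g ≟g o))))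
      (Ex-cong (choices m) (λ ω → sym (prob-Ex _≟g_ (signs m F Q ω) o))))

  collisionProb : ℕ → ℚ
  collisionProb k = Ex (uniform (subsetsOfSize d (2 ^ k))) (λ R →
    Ex (uniform (allFuns d R)) (λ r → toℚ (ind (collision? Q R r))))

  private
    D = (d ∸ S) * choose d S
    Z : ℕ → ℕ
    Z k = ∑Sub d S (weightOff Q k)

  -- The counts give the factors D · 4^k and 2^k; multiplying by 2^(K-k) / 2^k makes the left factor
  -- D · 2^K independent of k, and leaves on the right the weight 2^(K-k) of `geometric`.
  collisionProb-bound : S < d → ∀ k → k ∈ levels K →
    toℚ (D * 2 ^ K) *ℚ collisionProb k ≤ℚ toℚ (2 ^ (K ∸ k) * Z k)
  collisionProb-bound S<d k k∈ = rescale (2 ^ k) (2 ^ (K ∸ k)) (D * 2 ^ K) (D * 4 ^ k)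
    (2 ^ (K ∸ k) * Z k) (2 ^ k * Z k) (collisionProb k) (m^n>0 2 k) eA (perm (2 ^ k) (2 ^ (K ∸ k)) (Z k))
    (Ex-uniform-bound (subsetsOfSize d (2 ^ k)) _ (weight Q k) (4 ^ k) D (2 ^ k * Z k) perSubset
      (∑-weight Q k S (^-monoʳ-≤ 2 k≤K) S<d))
    where
    k≤K = proj₂ (∈-levels K k∈)
    perm : ∀ a b c → a * (b * c) ≡ b * (a * c)
    perm = solve-∀
    eA : 2 ^ k * (D * 2 ^ K) ≡ 2 ^ (K ∸ k) * (D * 4 ^ k)
    eA = trans (cong (λ z → 2 ^ k * (D * z)) (trans (cong (2 ^_) (sym (m∸n+n≡m k≤K))) (^-distribˡ-+-* 2 (K ∸ k) k)))
      (trans (regroup (2 ^ k) D (2 ^ (K ∸ k))) (cong (λ z → 2 ^ (K ∸ k) * (D * z)) (sym (4^≡2^*2^ k))))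
      where
      regroup : ∀ u b v → u * (b * (v * u)) ≡ v * (b * (u * u))
      regroup = solve-∀
    perSubset : ∀ R → R ∈ subsetsOfSize d (2 ^ k) →
      toℚ (4 ^ k) *ℚ Ex (uniform (allFuns d R)) (λ r → toℚ (ind (collision? Q R r))) ≤ℚ toℚ (weight Q k R)
    perSubset R R∈ = subst (λ z → toℚ z *ℚ _ ≤ℚ toℚ (weight Q k R)) (*-identityʳ (4 ^ k))
      (Ex-uniform-bound (allFuns d R) _ (λ r → ind (collision? Q R r)) 1 (4 ^ k) (weight Q k R)
        (λ r _ → ℚP.≤-reflexive (ℚP.*-identityˡ _))
        (∑-collision Q k (All.lookup (subset-unique d (2 ^ k)) R∈) (All.lookup (subset-length d (2 ^ k)) R∈)))

  tv-bound : S < d → toℚ (K * (D * 2 ^ K)) *ℚ tvGraphs m Q ≤ℚ toℚ (choose d S * (4 * 2 ^ K * length Q))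
  tv-bound S<d = ℚP.≤-trans (ℚP.*-monoˡ-≤-nonNeg (toℚ (K * (D * 2 ^ K))) {{toℚ-nonNeg (K * (D * 2 ^ K))}}
      (ℚP.≤-trans tv≤collision (ℚP.≤-reflexive (Ex-choices m _))))
    (Ex-uniform-bound (ks m) collisionProb (λ k → 2 ^ (K ∸ k) * Z k) (D * 2 ^ K) K N
      (collisionProb-bound S<d)
      (≤-trans (*-monoʳ-≤ K (∑-levels-weightOff Q K S)) (≤-reflexive (cong (_* N) (sym length-ks)))))
    where
    N = choose d S * (4 * 2 ^ K * length Q)
    length-ks : length (ks m) ≡ K
    length-ks = trans (length-map suc (upTo K)) (length-upTo K)

-- Size estimates and the final bound.

half≥1 : ∀ {m} → 2 ≤ m → 1 ≤ m ℕ./ 2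
half≥1 {m} 2≤m = m≥n⇒m/n>0 2≤m

double-2^half : ∀ {m} → 2 ≤ m → 2 * 2 ^ (m ℕ./ 2) ≤ 2 ^ m
double-2^half {m} 2≤m = ^-monoʳ-≤ 2 (m/n<m m 2 {{>-nonZero (≤-trans (s≤s z≤n) 2≤m)}} (s≤s (s≤s z≤n)))

-- The remainder of m modulo 2 is at most 1, hence at most the half itself once m ≥ 2.
m≤3*half : ∀ {m} → 2 ≤ m → m ≤ 3 * (m ℕ./ 2)
m≤3*half {m} 2≤m = begin
  m                               ≡⟨ m≡m%n+[m/n]*n m 2 ⟩
  m ℕ.% 2 + (m ℕ./ 2) * 2         ≤⟨ +-monoˡ-≤ ((m ℕ./ 2) * 2) (≤-trans (≤-pred (m%n<n m 2)) (half≥1 2≤m)) ⟩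
  m ℕ./ 2 + (m ℕ./ 2) * 2         ≡⟨ collect (m ℕ./ 2) ⟩
  3 * (m ℕ./ 2)                   ∎
  where
  open ≤-Reasoning
  collect : ∀ k → k + k * 2 ≡ 3 * k
  collect = solve-∀

2^m≤2*gap : ∀ {m} → 2 ≤ m → 2 ^ m ≤ 2 * (2 ^ m ∸ 2 ^ (m ℕ./ 2))
2^m≤2*gap {m} 2≤m = begin
  d               ≡⟨ sym (m+n∸n≡m d d) ⟩
  d + d ∸ d       ≤⟨ ∸-monoʳ-≤ (d + d) (double-2^half 2≤m) ⟩
  d + d ∸ 2 * S   ≡⟨ cong (_∸ 2 * S) (cong (_+_ d) (sym (+-identityʳ d))) ⟩
  2 * d ∸ 2 * S   ≡⟨ sym (*-distribˡ-∸ 2 d S) ⟩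
  2 * (d ∸ S)     ∎
  where
  open ≤-Reasoning
  d = 2 ^ m
  S = 2 ^ (m ℕ./ 2)

theorem3p5 : Σ ℚ λ C → Σ ℚ λ δ₀ → 0ℚ <ℚ δ₀ ×
    ((δ : ℚ) → 0ℚ <ℚ δ → δ <ℚ δ₀ →
    Σ ℕ λ M → (m : ℕ) → M ≤ m →
    (Q : List (Point m)) → Unique Q →
    toℚ (length Q) ≤ℚ δ *ℚ toℚ (2 ^ m * m) →
    tvGraphs m Q ≤ℚ C *ℚ δ)
-- 24 = 4 · 2 · 3: the 4 is from `geometric-bound`, the 2 from `2^m≤2*gap` and the 3 from
-- `m≤3*half`. The threshold M = 2 makes K ≥ 1 and 2 · 2^K ≤ d.
theorem3p5 = toℚ 24 , 1ℚ , ℚP.positive⁻¹ 1ℚ , λ δ δ>0 _ → 2 , λ m 2≤m Q _ |Q|≤ → bound δ δ>0 m 2≤m Q |Q|≤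
  where
  bound : ∀ δ → 0ℚ <ℚ δ → ∀ m → 2 ≤ m → (Q : List (Point m)) →
          toℚ (length Q) ≤ℚ δ *ℚ toℚ (2 ^ m * m) → tvGraphs m Q ≤ℚ toℚ 24 *ℚ δ
  bound δ δ>0 m 2≤m Q |Q|≤ = ℚP.*-cancelˡ-≤-pos (toℚ (K * (D * S))) {{toℚ-pos KDS>0}} (begin
    toℚ (K * (D * S)) *ℚ tvGraphs m Q               ≤⟨ tv-bound m Q S<d ⟩
    toℚ (c * (4 * S * length Q))                    ≡⟨ cong toℚ (regroup₁ c S (length Q)) ⟩
    toℚ (c * (4 * S) * length Q)                    ≡⟨ toℚ-* (c * (4 * S)) (length Q) ⟩
    toℚ (c * (4 * S)) *ℚ toℚ (length Q)             ≤⟨ ℚP.*-monoˡ-≤-nonNeg (toℚ (c * (4 * S))) {{toℚ-nonNeg (c * (4 * S))}} |Q|≤ ⟩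
    toℚ (c * (4 * S)) *ℚ (δ *ℚ toℚ (d * m))         ≡⟨ regroup₂ (toℚ (c * (4 * S))) δ (toℚ (d * m)) ⟩
    δ *ℚ (toℚ (c * (4 * S)) *ℚ toℚ (d * m))         ≡⟨ cong (δ *ℚ_) (sym (toℚ-* (c * (4 * S)) (d * m))) ⟩
    δ *ℚ toℚ (c * (4 * S) * (d * m))                ≤⟨ ℚP.*-monoˡ-≤-nonNeg δ {{ℚP.pos⇒nonNeg δ {{ℚ.positive δ>0}}}} (toℚ-mono-≤ sizes) ⟩
    δ *ℚ toℚ (K * (D * S) * 24)                     ≡⟨ cong (δ *ℚ_) (toℚ-* (K * (D * S)) 24) ⟩
    δ *ℚ (toℚ (K * (D * S)) *ℚ toℚ 24)              ≡⟨ regroup₃ δ (toℚ (K * (D * S))) (toℚ 24) ⟩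
    toℚ (K * (D * S)) *ℚ (toℚ 24 *ℚ δ)              ∎)
    where
    open ℚP.≤-Reasoning
    d = 2 ^ m
    K = m ℕ./ 2
    S = 2 ^ K
    c = choose d S
    D = (d ∸ S) * c
    S<d : S < d
    S<d = <-≤-trans (m<m+n S (≤-trans (m^n>0 2 K) (m≤m+n S 0))) (double-2^half 2≤m)
    KDS>0 : 0 < K * (D * S)
    KDS>0 = *-mono-≤ (half≥1 2≤m) (*-mono-≤ (*-mono-≤ (m<n⇒0<n∸m S<d) (choose-pos d S (<⇒≤ S<d))) (m^n>0 2 K))
    regroup₁ : ∀ c S q → c * (4 * S * q) ≡ c * (4 * S) * q
    regroup₁ = solve-∀
    regroup₂ : ∀ x δ y → x *ℚ (δ *ℚ y) ≡ δ *ℚ (x *ℚ y)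
    regroup₂ = RingSolver.solve-∀ ℚ-ring
    regroup₃ : ∀ δ x y → δ *ℚ (x *ℚ y) ≡ x *ℚ (y *ℚ δ)
    regroup₃ = RingSolver.solve-∀ ℚ-ring
    sizes : c * (4 * S) * (d * m) ≤ K * (D * S) * 24
    sizes = ≤-trans (*-monoʳ-≤ (c * (4 * S)) (*-mono-≤ (2^m≤2*gap 2≤m) (m≤3*half 2≤m)))
                    (≤-reflexive (regroup₄ c S (d ∸ S) K))
      where
      regroup₄ : ∀ c S g K → c * (4 * S) * (2 * g * (3 * K)) ≡ K * (g * c * S) * 24
      regroup₄ = solve-∀
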